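{- The proof system $\mathbf{SC}_{\min}$ is complete with respect to the class of minimal simplicial models, and the proof system $\mathbf{SC}_{\max}$ is complete with respect to the class of maximal simplicial models: every formula of $\mathcal L_D$ true at every world of every minimal (resp. maximal) simplicial model is provable in $\mathbf{SC}_{\min}$ (resp. $\mathbf{SC}_{\max}$).
   Context: Fix a finite set $A$ of agents and a countable set $\mathsf{AP}$. $\mathcal L_D$: $\varphi::=p\mid\neg\varphi\mid\varphi\wedge\varphi\mid D_B\varphi$, $p\in\mathsf{AP}$, $\emptyset\ne B\subseteq A$; $K_a\varphi:=D_{\{a\}}\varphi$, $\mathsf{dead}(a):=K_a\bot$, $\mathsf{alive}(a):=\neg\mathsf{dead}(a)$, $\mathsf{dead}(B):=\bigwedge_{a\in B}\mathsf{dead}(a)$ (empty conjunction $=\top$), $\mathsf{alive}(B):=\neg D_B\bot$, $\overline B=A\setminus B$. $\mathbf{SC}$: propositional tautologies, modus ponens, necessitation (from $\varphi$ infer $D_B\varphi$), and for non-empty $B,B'$: $D_B(\varphi\Rightarrow\psi)\Rightarrow(D_B\varphi\Rightarrow D_B\psi)$; $\varphi\Rightarrow D_B\neg D_B\neg\varphi$; $D_B\varphi\Rightarrow D_BD_B\varphi$; $D_B\varphi\Rightarrow D_{B'}\varphi$ ($B\subseteq B'$); $\mathsf{alive}(B)\wedge\mathsf{alive}(B')\Rightarrow\mathsf{alive}(B\cup B')$; $\bigvee_{a\in A}\mathsf{alive}(a)$; $\mathsf{alive}(B)\wedge\mathsf{dead}(\overline B)\wedge\varphi\Rightarrow D_B(\mathsf{dead}(\overline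 B)\Rightarrow\varphi)$. $\mathbf{SC}_{\min}$ is $\mathbf{SC}$ plus $\mathsf{alive}(B)\wedge\mathsf{dead}(\overline B)\Rightarrow D_B\mathsf{dead}(\overline B)$ for $B\subsetneq A$; $\mathbf{SC}_{\max}$ is $\mathbf{SC}$ plus $\mathsf{alive}(B)\Rightarrow\neg D_B\neg\mathsf{dead}(\overline B)$ for $B\subsetneq A$. A chromatic simplicial complex is $\langle V,S,\chi\rangle$ with $S$ a family of non-empty subsets of $V$ containing all singletons and closed under non-empty subsets, $\chi:V\to A$ injective on each simplex. A generalized simplicial model is $\mathcal C=\langle V,S,\chi,W,\ell\rangle$ with $\mathrm{Facets}\subseteq W\subseteq S$ and $\ell:W\to\mathcal P(\mathsf{AP})$; minimal if $W$ is the set of facets (maximal simplices), maximal if $W=S$. Satisfaction: $\mathcal C,w\models p$ iff $p\in\ell(w)$; boolean clauses standard; $\mathcal C,w\models D_B\varphi$ iff $\mathcal C,w'\models\varphi$ for all $w'\in W$ with $B\subseteq\chi(w\cap w')$. -}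

module Defs where

open import Data.Nat using (ℕ; zero)
open import Data.Bool using (Bool; true; false; not; _∧_; if_then_else_)
open import Data.Fin using (Fin)
open import Data.Fin.Subset using (Subset; _∈_; Nonempty; ⁅_⁆; ∁; _∪_) renaming (_⊆_ to _⊆ˢ_)
open import Data.Fin.Subset.Properties using (x∈⁅x⁆; p⊆p∪q)
open import Data.Vec using (lookup)
open import Data.List using (List; foldr; allFin)
open import Data.Product using (Σ; ∃; _×_; _,_)
open import Data.Empty using (⊥)
open import Relation.Nullary using (¬_; yes; no)
open import Relation.Binary.PropositionalEquality using (_≡_)
open import Level using (Level) renaming (suc to lsuc; zero to lzero)

-- Language L_D over agents A = Fin n and atoms AP = ℕ.
-- D B φ is only formed for non-empty B (irrelevant non-emptiness proof).

data Form (n : ℕ) : Set where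
  atom : ℕ → Form n
  ¬ᶠ_  : Form n → Form n
  _∧ᶠ_ : Form n → Form n → Form n
  D    : (B : Subset n) → .(Nonempty B) → Form n → Form n

infixr 6 _∧ᶠ_

module _ {n : ℕ} where

  infixr 5 _∨ᶠ_
  infixr 4 _⇒_

  -- fixed falsum / verum (AP is non-empty, atom 0 exists)
  ⊥ᶠ : Form n
  ⊥ᶠ = atom 0 ∧ᶠ ¬ᶠ atom 0

  ⊤ᶠ : Form n
  ⊤ᶠ = ¬ᶠ ⊥ᶠ

  _∨ᶠ_ : Form n → Form n → Form n
  φ ∨ᶠ ψ = ¬ᶠ (¬ᶠ φ ∧ᶠ ¬ᶠ ψ)

  _⇒_ : Form n → Form n → Form n
  φ ⇒ ψ = ¬ᶠ (φ ∧ᶠ ¬ᶠ ψ)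

  K : Fin n → Form n → Form n
  K a φ = D ⁅ a ⁆ (a , x∈⁅x⁆ a) φ

  dead : Fin n → Form n
  dead a = K a ⊥ᶠ

  alive : Fin n → Form n
  alive a = ¬ᶠ dead a

  deadS : Subset n → Form n
  deadS B = foldr (λ a acc → if isIn a then dead a ∧ᶠ acc else acc) ⊤ᶠ (allFin n)
    where
    isIn : Fin n → Bool
    isIn a = lookup B a

  aliveS : (B : Subset n) → .(Nonempty B) → Form n
  aliveS B ne = ¬ᶠ D B ne ⊥ᶠ

  someAlive : Form n
  someAlive = foldr (λ a acc → alive a ∨ᶠ acc) ⊥ᶠ (allFin n)

  evalB : (Form n → Bool) → Form n → Bool
  evalB v (atom i)    = v (atom i)
  evalB v (¬ᶠ φ)      = not (evalB v φ)
  evalB v (φ ∧ᶠ ψ)    = evalB v φ ∧ evalB v ψ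
  evalB v (D B ne φ)  = v (D B ne φ)

  Tautology : Form n → Set
  Tautology φ = ∀ (v : Form n → Bool) → evalB v φ ≡ true

data Variant : Set where
  min max : Variant

data _⊢_ {n : ℕ} (s : Variant) : Form n → Set where
  taut  : ∀ {φ} → Tautology φ → s ⊢ φ
  mp    : ∀ {φ ψ} → s ⊢ (φ ⇒ ψ) → s ⊢ φ → s ⊢ ψ
  nec   : ∀ {φ} B .(ne : Nonempty B) → s ⊢ φ → s ⊢ D B ne φ
  axK   : ∀ B .(ne : Nonempty B) φ ψ →
          s ⊢ (D B ne (φ ⇒ ψ) ⇒ (D B ne φ ⇒ D B ne ψ))
  axB   : ∀ B .(ne : Nonempty B) φ →
          s ⊢ (φ ⇒ D B ne (¬ᶠ D B ne (¬ᶠ φ)))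
  ax4   : ∀ B .(ne : Nonempty B) φ →
          s ⊢ (D B ne φ ⇒ D B ne (D B ne φ))
  axMono : ∀ B B' .(ne : Nonempty B) .(ne' : Nonempty B') φ → B ⊆ˢ B' →
          s ⊢ (D B ne φ ⇒ D B' ne' φ)
  axUnion : ∀ B B' .(ne : Nonempty B) .(ne' : Nonempty B') .(ne∪ : Nonempty (B ∪ B')) →
          s ⊢ (aliveS B ne ∧ᶠ aliveS B' ne' ⇒ aliveS (B ∪ B') ne∪)
  axAlive : s ⊢ someAlive
  axDead : ∀ B .(ne : Nonempty B) φ →
          s ⊢ (aliveS B ne ∧ᶠ deadS (∁ B) ∧ᶠ φ ⇒ D B ne (deadS (∁ B) ⇒ φ))
  axMin : s ≡ min → ∀ B .(ne : Nonempty B) → Nonempty (∁ B) →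
          s ⊢ (aliveS B ne ∧ᶠ deadS (∁ B) ⇒ D B ne (deadS (∁ B)))
  axMax : s ≡ max → ∀ B .(ne : Nonempty B) → Nonempty (∁ B) →
          s ⊢ (aliveS B ne ⇒ ¬ᶠ D B ne (¬ᶠ deadS (∁ B)))

Pred : Set → Set₁
Pred V = V → Set

_⊆_ : ∀ {V : Set} → Pred V → Pred V → Set
X ⊆ Y = ∀ {v} → X v → Y v

_≐_ : ∀ {V : Set} → Pred V → Pred V → Set
X ≐ Y = (X ⊆ Y) × (Y ⊆ X)

NonEmptyP : ∀ {V : Set} → Pred V → Set
NonEmptyP {V} X = Σ V X

record Model (n : ℕ) : Set₁ where
  field
    V   : Set
    χ   : V → Fin n
    S   : Pred V → Set
    S-nonempty  : ∀ X → S X → NonEmptyP X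
    S-singleton : ∀ v → S (λ u → u ≡ v)
    S-down      : ∀ X Y → S X → Y ⊆ X → NonEmptyP Y → S Y
    chromatic   : ∀ X → S X → ∀ u v → X u → X v → χ u ≡ χ v → u ≡ v

  Facet : Pred V → Set₁
  Facet X = S X × (∀ Y → S Y → X ⊆ Y → Y ⊆ X)

  field
    W   : Pred V → Set
    W-resp    : ∀ X Y → X ≐ Y → W X → W Y
    facet⊆W   : ∀ X → Facet X → W X
    W⊆S       : ∀ X → W X → S X
    ℓ   : Pred V → ℕ → Set
    ℓ-resp    : ∀ X Y p → X ≐ Y → ℓ X p → ℓ Y p

open Model public

IsMinimal : ∀ {n} → Model n → Set₁
IsMinimal M = ∀ X → W M X → Facet M X

IsMaximal : ∀ {n} → Model n → Set₁
IsMaximal M = ∀ X → S M X → W M X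

_⊆χ_∩_ : ∀ {n} {M : Model n} → Subset n → Pred (V M) → Pred (V M) → Set
_⊆χ_∩_ {M = M} B w w' = ∀ a → a ∈ B → Σ (V M) λ v → w v × w' v × χ M v ≡ a

_,_⊨_ : ∀ {n} (M : Model n) → Pred (V M) → Form n → Set₁
M , w ⊨ atom p   = Level.Lift _ (ℓ M w p)
M , w ⊨ (¬ᶠ φ)   = ¬ (M , w ⊨ φ)
M , w ⊨ (φ ∧ᶠ ψ) = (M , w ⊨ φ) × (M , w ⊨ ψ)
M , w ⊨ D B _ φ  = ∀ w' → W M w' → _⊆χ_∩_ {M = M} B w w' → M , w' ⊨ φ

ValidMin : ∀ {n} → Form n → Set₁
ValidMin {n} φ = ∀ (M : Model n) → IsMinimal M → ∀ w → W M w → M , w ⊨ φ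

ValidMax : ∀ {n} → Form n → Set₁
ValidMax {n} φ = ∀ (M : Model n) → IsMaximal M → ∀ w → W M w → M , w ⊨ φ

{-# OPTIONS --safe #-}
module Submission where

-- Validity must yield an actual derivation, so instead of maximal consistent sets one
-- starts from all valuations of a finite set Γ of formulas and repeatedly discards those
-- whose characteristic formula is refutable: because an instance of an axiom fails, or
-- because some ¬ D B ψ has no witness among the remaining valuations. If every survivor
-- satisfies φ, then φ is derivable. Otherwise the survivors form a pseudo-model, a Kripke
-- model in which D B is interpreted by a partial equivalence relation monotone in B, and φ
-- fails in it. Unravelling it into a tree of paths, where crossing an edge labelled B keeps
-- exactly the vertices coloured by B, gives a simplicial model in which the same formulas
-- hold: paths sharing their B-coloured vertices end in related worlds, since the labels of
-- all edges between them contain B. Here axDead makes the atoms at a face with exactly B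
-- alive well defined, axMin forces the simplices of paths to be facets, and axMax provides
-- a path for every face of a simplex.

open import Defs
open import Data.Bool using (Bool; true; false; not; _∧_; if_then_else_)
import Data.Bool.Properties as Bool
open import Data.Empty using (⊥-elim)
open import Data.Fin using (Fin; zero; suc)
import Data.Fin.Properties as Fin
open import Data.Fin.Subset using (Subset; Nonempty; inside; outside; ⁅_⁆; ∁; _∪_; _⊈_)
  renaming (_∈_ to _∈ˢ_; _∉_ to _∉ˢ_; _⊆_ to _⊆ˢ_)
open import Data.Fin.Subset.Properties
  using (x∈⁅x⁆; x∈⁅y⁆⇒x≡y; nonempty?; Empty-unique; ∪-identityˡ; p⊆p∪q; q⊆p∪q;
         x∈∁p⇒x∉p; x∉∁p⇒x∈p)
  renaming (_∈?_ to _∈ˢ?_; _⊆?_ to _⊆ˢ?_)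
open import Data.List
  using (List; []; _∷_; _++_; map; foldr; filter; concatMap; cartesianProductWith; allFin; length)
import Data.List.Membership.DecPropositional as DecMembership
open import Data.List.Membership.Propositional using (_∈_; find; lose)
open import Data.List.Membership.Propositional.Properties
  using (∈-++⁺ˡ; ∈-++⁺ʳ; ∈-++⁻; ∈-map⁺; ∈-concatMap⁺; ∈-concatMap⁻; ∈-cartesianProductWith⁺;
         ∈-filter⁺; ∈-filter⁻; ∈-allFin)
open import Data.List.Properties using (filter-notAll)
open import Data.List.Relation.Unary.All as All using (All; []; _∷_)
import Data.List.Relation.Unary.All.Properties as All
open import Data.List.Relation.Unary.Any as Any using (Any; here; there)
open import Data.Nat using (ℕ; zero; suc; _≤_; _<_)
open import Data.Nat.Induction using (<-wellFounded)
import Data.Nat.Properties as ℕ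
open import Data.Product using (∃; _×_; _,_; proj₁; proj₂)
open import Data.Sum using (_⊎_; inj₁; inj₂; [_,_]′)
open import Data.Unit using (⊤; tt)
open import Data.Vec using ([]; _∷_; here; there; lookup; tabulate)
open import Data.Vec.Properties using (lookup⇒[]=; []=⇒lookup; lookup∘tabulate; ≡-dec)
open import Effect.Monad using (RawMonad)
open import Function using (_∘_; id; const; _⇔_; mk⇔; Equivalence)
open import Induction.WellFounded using (Acc; acc)
open import Level using (Level; lift; lower)
open import Relation.Binary using (DecidableEquality)
open import Relation.Binary.PropositionalEquality
  using (_≡_; refl; sym; trans; cong; cong₂; subst; module ≡-Reasoning)
open import Relation.Nullary
  using (¬_; Dec; yes; no; does; ¬?; _×-dec_; _→-dec_; contradiction; Stable)
open import Relation.Nullary.Decidable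
  using (map′; recompute; decidable-stable; dec-true; ¬¬-excluded-middle)
open import Relation.Nullary.Negation using (¬¬-Monad; ¬¬-map; negated-stable)
open import Relation.Unary.Properties using (≐-refl; ≐-sym; ≐-trans)

private
  variable
    ℓ₁ ℓ₂ ℓ₃ : Level
    n        : ℕ
    s        : Variant
    φ ψ γ    : Form n

-- Finite subsets and lists

⁅⁆⊆ : ∀ {a} {B : Subset n} → a ∈ˢ B → ⁅ a ⁆ ⊆ˢ B
⁅⁆⊆ {B = B} a∈B x∈⁅a⁆ = subst (_∈ˢ B) (sym (x∈⁅y⁆⇒x≡y _ x∈⁅a⁆)) a∈B

⊈⇒∃∉ : ∀ (B C : Subset n) → B ⊈ C → ∃ λ a → a ∈ˢ B × a ∉ˢ C
⊈⇒∃∉ {n} B C B⊈C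
  with Fin.¬∀⟶∃¬ n _ (λ a → (a ∈ˢ? B) →-dec (a ∈ˢ? C)) (λ B⊆C → B⊈C (B⊆C _))
... | a , ¬[a∈B→a∈C] = a , a∈B , λ a∈C → ¬[a∈B→a∈C] λ _ → a∈C
  where
  a∈B : a ∈ˢ B
  a∈B = decidable-stable (a ∈ˢ? B) λ a∉B → ¬[a∈B→a∈C] λ a∈B → contradiction a∈B a∉B

module _ {P : Fin n → Set ℓ₁} where

  comprehension : (∀ a → Dec (P a)) → Subset n
  comprehension P? = tabulate (does ∘ P?)

  ∈-comprehension⁺ : ∀ P? {a} → P a → a ∈ˢ comprehension P?
  ∈-comprehension⁺ P? {a} Pa =
    lookup⇒[]= a _ (trans (lookup∘tabulate (does ∘ P?) a) (dec-true (P? a) Pa))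

  ∈-comprehension⁻ : ∀ P? {a} → a ∈ˢ comprehension P? → P a
  ∈-comprehension⁻ P? {a} a∈
    with P? a | trans (sym (lookup∘tabulate (does ∘ P?) a)) ([]=⇒lookup a∈)
  ... | yes Pa | _ = Pa

  ¬¬-comprehension : ¬ ¬ ∃ λ B → ∀ a → a ∈ˢ B ⇔ P a
  ¬¬-comprehension =
    ¬¬-map (λ P? → comprehension P? , λ _ → mk⇔ (∈-comprehension⁻ P?) (∈-comprehension⁺ P?))
           (Fin.sequence (RawMonad.rawApplicative ¬¬-Monad) λ _ → ¬¬-excluded-middle)

nonempty-induction : (P : Subset n → Set ℓ₁) →
                     (∀ a → P ⁅ a ⁆) → (∀ {B C} → P B → P C → P (B ∪ C)) →
                     ∀ B → Nonempty B → P B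
nonempty-induction P P⁅⁆ P∪ (outside ∷ B) (suc a , there a∈B) =
  nonempty-induction (P ∘ (outside ∷_)) (P⁅⁆ ∘ suc) P∪ B (a , a∈B)
nonempty-induction P P⁅⁆ P∪ (inside ∷ B) _ with nonempty? B
... | no empty = subst (P ∘ (inside ∷_)) (sym (Empty-unique empty)) (P⁅⁆ zero)
... | yes B≢∅  = subst (P ∘ (inside ∷_)) (∪-identityˡ B) (P∪ (P⁅⁆ zero) P[outside∷B])
  where
  P[outside∷B] : P (outside ∷ B)
  P[outside∷B] = nonempty-induction (P ∘ (outside ∷_)) (P⁅⁆ ∘ suc) P∪ B B≢∅

booleans : List Bool
booleans = true ∷ false ∷ []

∈-booleans : ∀ b → b ∈ booleans
∈-booleans true  = here refl
∈-booleans false = there (here refl)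

subsets : ∀ n → List (Subset n)
subsets zero    = [] ∷ []
subsets (suc n) = cartesianProductWith _∷_ booleans (subsets n)

∈-subsets : (B : Subset n) → B ∈ subsets n
∈-subsets []      = here refl
∈-subsets (b ∷ B) = ∈-cartesianProductWith⁺ _∷_ (∈-booleans b) (∈-subsets B)

nonemptySubsets : ∀ n → List (∃ (Nonempty {n}))
nonemptySubsets zero    = []
nonemptySubsets (suc n) =
  map (λ B → inside ∷ B , zero , here) (subsets n) ++
  map (λ (B , a , a∈B) → outside ∷ B , suc a , there a∈B) (nonemptySubsets n)

∈-nonemptySubsets : (B : Subset n) → Nonempty B → ∃ λ B≢∅ → (B , B≢∅) ∈ nonemptySubsets n
∈-nonemptySubsets (inside  ∷ B) _ = _ , ∈-++⁺ˡ (∈-map⁺ _ (∈-subsets B))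
∈-nonemptySubsets (outside ∷ B) (suc a , there a∈B) =
  _ , ∈-++⁺ʳ _ (∈-map⁺ _ (proj₂ (∈-nonemptySubsets B (a , a∈B))))

module _ {A : Set ℓ₁} (_≟_ : DecidableEquality A) where

  override : A → Bool → (A → Bool) → A → Bool
  override x b f y = if does (x ≟ y) then b else f y

  functionsOn : List A → List (A → Bool)
  functionsOn []       = const false ∷ []
  functionsOn (x ∷ xs) = cartesianProductWith (override x) booleans (functionsOn xs)

  override-≡ : ∀ x b f → override x b f x ≡ b
  override-≡ x b f rewrite dec-true (x ≟ x) refl = refl

  override-agrees : ∀ (f g : A → Bool) x {y} → f y ≡ g y → f y ≡ override x (f x) g y
  override-agrees f g x {y} fy≡gy with x ≟ y
  ... | yes refl = refl
  ... | no _     = fy≡gy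

  functionsOn-complete : (f : A → Bool) → ∀ xs →
                         ∃ λ g → g ∈ functionsOn xs × All (λ x → f x ≡ g x) xs
  functionsOn-complete f []       = const false , here refl , []
  functionsOn-complete f (x ∷ xs) with functionsOn-complete f xs
  ... | g , g∈ , f≡g =
        override x (f x) g ,
        ∈-cartesianProductWith⁺ (override x) (∈-booleans (f x)) g∈ ,
        sym (override-≡ x (f x) g) ∷ All.map (override-agrees f g x) f≡g

module _ {A : Set ℓ₁} {Keep : List A → A → Set ℓ₂} (keep? : ∀ xs x → Dec (Keep xs x))
         (Inv : List A → Set ℓ₃) (filter-Inv : ∀ {xs} → Inv xs → Inv (filter (keep? xs) xs)) where

  filter-fixpoint : ∀ xs → Inv xs → ∃ λ ys → Inv ys × All (Keep ys) ys
  filter-fixpoint xs = go xs (<-wellFounded (length xs))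
    where
    go : ∀ xs → Acc _<_ (length xs) → Inv xs → ∃ λ ys → Inv ys × All (Keep ys) ys
    go xs (acc smaller) inv with All.all? (keep? xs) xs
    ... | yes all-kept = xs , inv , all-kept
    ... | no ¬all-kept = go (filter (keep? xs) xs) (smaller shorter) (filter-Inv inv)
      where
      shorter : length (filter (keep? xs) xs) < length xs
      shorter = filter-notAll (keep? xs) xs (All.¬All⇒Any¬ (keep? xs) xs ¬all-kept)

-- Valuations

Valuation : ℕ → Set
Valuation n = Form n → Bool

infix 4 _⊩_ _⊩?_

record _⊩_ (v : Valuation n) (φ : Form n) : Set where
  constructor holds
  field evaluates : evalB v φ ≡ true

open _⊩_

_⊩?_ : (v : Valuation n) (φ : Form n) → Dec (v ⊩ φ)
v ⊩? φ = map′ holds evaluates (evalB v φ Bool.≟ true)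

module _ {v : Valuation n} where

  ⊩-stable : Stable (v ⊩ φ)
  ⊩-stable = decidable-stable (v ⊩? _)

  ¬-intro : ¬ v ⊩ φ → v ⊩ ¬ᶠ φ
  ¬-intro ⊮φ = holds (cong not (Bool.¬-not (⊮φ ∘ holds)))

  ¬-elim : v ⊩ ¬ᶠ φ → ¬ v ⊩ φ
  ¬-elim (holds ¬φ) (holds φ) = Bool.not-¬ φ (Bool.not-injective ¬φ)

  ¬¬-elim : v ⊩ ¬ᶠ ¬ᶠ φ → v ⊩ φ
  ¬¬-elim ¬¬φ = ⊩-stable (¬-elim ¬¬φ ∘ ¬-intro)

  ∧-intro : v ⊩ φ → v ⊩ ψ → v ⊩ φ ∧ᶠ ψ
  ∧-intro (holds φ) (holds ψ) = holds (cong₂ _∧_ φ ψ)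

  ∧-elimˡ : v ⊩ φ ∧ᶠ ψ → v ⊩ φ
  ∧-elimˡ (holds φ∧ψ) = holds (Bool.∧-conicalˡ _ _ φ∧ψ)

  ∧-elimʳ : v ⊩ φ ∧ᶠ ψ → v ⊩ ψ
  ∧-elimʳ {φ = φ} (holds φ∧ψ) = holds (Bool.∧-conicalʳ (evalB v φ) _ φ∧ψ)

  ⇒-intro : (v ⊩ φ → v ⊩ ψ) → v ⊩ (φ ⇒ ψ)
  ⇒-intro φ→ψ = ¬-intro λ φ∧¬ψ → ¬-elim (∧-elimʳ φ∧¬ψ) (φ→ψ (∧-elimˡ φ∧¬ψ))

  ⇒-elim : v ⊩ (φ ⇒ ψ) → v ⊩ φ → v ⊩ ψ
  ⇒-elim φ⇒ψ φ = ⊩-stable λ ⊮ψ → ¬-elim φ⇒ψ (∧-intro φ (¬-intro ⊮ψ))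

  ⊮⊥ : ¬ v ⊩ ⊥ᶠ
  ⊮⊥ ⊩⊥ = ¬-elim (∧-elimʳ ⊩⊥) (∧-elimˡ ⊩⊥)

  ⊩⊤ : v ⊩ ⊤ᶠ
  ⊩⊤ = ¬-intro ⊮⊥

  ∨-introˡ : v ⊩ φ → v ⊩ φ ∨ᶠ ψ
  ∨-introˡ φ = ¬-intro λ ¬φ∧¬ψ → ¬-elim (∧-elimˡ ¬φ∧¬ψ) φ

  ∨-introʳ : v ⊩ ψ → v ⊩ φ ∨ᶠ ψ
  ∨-introʳ ψ = ¬-intro λ ¬φ∧¬ψ → ¬-elim (∧-elimʳ ¬φ∧¬ψ) ψ

  ∨-elim : v ⊩ φ ∨ᶠ ψ → v ⊩ φ ⊎ v ⊩ ψ
  ∨-elim {φ = φ} φ∨ψ with v ⊩? φ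
  ... | yes φ = inj₁ φ
  ... | no ⊮φ = inj₂ (⊩-stable λ ⊮ψ → ¬-elim φ∨ψ (∧-intro (¬-intro ⊮φ) (¬-intro ⊮ψ)))

-- someAlive and deadS B unfold to ⋁ alive (allFin n) and ⋀ˢ B dead.

⋀ : {A : Set ℓ₁} → (A → Bool) → (A → Form n) → List A → Form n
⋀ p f = foldr (λ x acc → if p x then f x ∧ᶠ acc else acc) ⊤ᶠ

⋀ˢ : Subset n → (Fin n → Form n) → Form n
⋀ˢ B f = ⋀ (lookup B) f (allFin _)

⋁ : {A : Set ℓ₁} → (A → Form n) → List A → Form n
⋁ f = foldr (λ x acc → f x ∨ᶠ acc) ⊥ᶠ

module _ {v : Valuation n} where

  module _ {A : Set ℓ₁} (p : A → Bool) (f : A → Form n) where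

    ⋀-intro : ∀ xs → (∀ {x} → x ∈ xs → p x ≡ true → v ⊩ f x) → v ⊩ ⋀ p f xs
    ⋀-intro []       _  = ⊩⊤
    ⋀-intro (x ∷ xs) ⊩f with p x in px
    ... | true  = ∧-intro (⊩f (here refl) px) (⋀-intro xs (⊩f ∘ there))
    ... | false = ⋀-intro xs (⊩f ∘ there)

    ⋀-elim : ∀ {xs x} → v ⊩ ⋀ p f xs → x ∈ xs → p x ≡ true → v ⊩ f x
    ⋀-elim {_ ∷ _} ⊩⋀ (here refl) px rewrite px = ∧-elimˡ ⊩⋀
    ⋀-elim {y ∷ _} ⊩⋀ (there x∈)  px with p y
    ... | true  = ⋀-elim (∧-elimʳ ⊩⋀) x∈ px
    ... | false = ⋀-elim ⊩⋀ x∈ px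

  module _ (B : Subset n) (f : Fin n → Form n) where

    ⋀ˢ-intro : (∀ {a} → a ∈ˢ B → v ⊩ f a) → v ⊩ ⋀ˢ B f
    ⋀ˢ-intro ⊩f = ⋀-intro (lookup B) f (allFin n) λ {a} _ → ⊩f ∘ lookup⇒[]= a B

    ⋀ˢ-elim : ∀ {a} → v ⊩ ⋀ˢ B f → a ∈ˢ B → v ⊩ f a
    ⋀ˢ-elim {a} ⊩⋀ a∈B = ⋀-elim (lookup B) f ⊩⋀ (∈-allFin a) ([]=⇒lookup a∈B)

  module _ {A : Set ℓ₁} (f : A → Form n) where

    ⋁-intro : ∀ {xs x} → x ∈ xs → v ⊩ f x → v ⊩ ⋁ f xs
    ⋁-intro (here refl) ⊩fx = ∨-introˡ ⊩fx
    ⋁-intro (there x∈)  ⊩fx = ∨-introʳ (⋁-intro x∈ ⊩fx)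

    ⋁-elim : ∀ xs → v ⊩ ⋁ f xs → ∃ λ x → x ∈ xs × v ⊩ f x
    ⋁-elim []       ⊩⋁ = contradiction ⊩⋁ ⊮⊥
    ⋁-elim (x ∷ xs) ⊩⋁ with ∨-elim ⊩⋁
    ... | inj₁ ⊩fx = x , here refl , ⊩fx
    ... | inj₂ ⊩fs = let y , y∈ , ⊩fy = ⋁-elim xs ⊩fs in y , there y∈ , ⊩fy

aliveAll : Subset n → Form n
aliveAll B = ⋀ˢ B alive

aliveSet : Valuation n → Subset n
aliveSet w = comprehension λ a → w ⊩? alive a

module _ {w : Valuation n} where

  ∈-aliveSet⁺ : ∀ {a} → w ⊩ alive a → a ∈ˢ aliveSet w
  ∈-aliveSet⁺ = ∈-comprehension⁺ λ a → w ⊩? alive a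

  ∈-aliveSet⁻ : ∀ {a} → a ∈ˢ aliveSet w → w ⊩ alive a
  ∈-aliveSet⁻ = ∈-comprehension⁻ λ a → w ⊩? alive a

  ⊆aliveSet⇒aliveAll : ∀ {B} → B ⊆ˢ aliveSet w → w ⊩ aliveAll B
  ⊆aliveSet⇒aliveAll {B} B⊆aliveSet = ⋀ˢ-intro B alive (∈-aliveSet⁻ ∘ B⊆aliveSet)

  aliveAll⇒⊆aliveSet : ∀ {B} → w ⊩ aliveAll B → B ⊆ˢ aliveSet w
  aliveAll⇒⊆aliveSet {B} ⊩aliveAll = ∈-aliveSet⁺ ∘ ⋀ˢ-elim B alive ⊩aliveAll

  aliveSet⊆⇒deadS-∁ : ∀ {B} → aliveSet w ⊆ˢ B → w ⊩ deadS (∁ B)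
  aliveSet⊆⇒deadS-∁ {B} aliveSet⊆B = ⋀ˢ-intro (∁ B) dead λ a∈∁B → ⊩-stable λ ⊮dead →
    x∈∁p⇒x∉p a∈∁B (aliveSet⊆B (∈-aliveSet⁺ (¬-intro ⊮dead)))

  deadS-∁⇒aliveSet⊆ : ∀ {B} → w ⊩ deadS (∁ B) → aliveSet w ⊆ˢ B
  deadS-∁⇒aliveSet⊆ {B} ⊩deadS a∈aliveSet = x∉∁p⇒x∈p λ a∈∁B →
    ¬-elim (∈-aliveSet⁻ a∈aliveSet) (⋀ˢ-elim (∁ B) dead ⊩deadS a∈∁B)

-- Derivable formulas

infer : ∀ {Θ} → All (s ⊢_) Θ → (∀ {v} → All (v ⊩_) Θ → v ⊩ φ) → s ⊢ φ
infer []        consequence = taut λ _ → evaluates (consequence [])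
infer (⊢θ ∷ ⊢Θ) consequence =
  mp (infer ⊢Θ λ ⊩Θ → ⇒-intro λ ⊩θ → consequence (⊩θ ∷ ⊩Θ)) ⊢θ

⇒-const : s ⊢ φ → s ⊢ (γ ⇒ φ)
⇒-const ⊢φ = infer (⊢φ ∷ []) λ { (φ ∷ []) → ⇒-intro λ _ → φ }

⇒-trans : s ⊢ (φ ⇒ ψ) → s ⊢ (ψ ⇒ γ) → s ⊢ (φ ⇒ γ)
⇒-trans ⊢φ⇒ψ ⊢ψ⇒γ = infer (⊢φ⇒ψ ∷ ⊢ψ⇒γ ∷ []) λ
  { (φ⇒ψ ∷ ψ⇒γ ∷ []) → ⇒-intro (⇒-elim ψ⇒γ ∘ ⇒-elim φ⇒ψ) }

⇒-⋀ : ∀ {A : Set ℓ₁} (p : A → Bool) (f : A → Form n) xs →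
      (∀ {x} → p x ≡ true → s ⊢ (γ ⇒ f x)) → s ⊢ (γ ⇒ ⋀ p f xs)
⇒-⋀ p f []       γ⇒f = ⇒-const (infer [] λ _ → ⊩⊤)
⇒-⋀ p f (x ∷ xs) γ⇒f with p x in px
... | false = ⇒-⋀ p f xs γ⇒f
... | true  = infer (γ⇒f px ∷ ⇒-⋀ p f xs γ⇒f ∷ []) λ
      { (γ⇒fx ∷ γ⇒fs ∷ []) → ⇒-intro λ γ → ∧-intro (⇒-elim γ⇒fx γ) (⇒-elim γ⇒fs γ) }

⋁-filter : ∀ {A : Set ℓ₁} {P : A → Set ℓ₂} (P? : ∀ x → Dec (P x)) (f : A → Form n) →
           (∀ {x} → ¬ P x → s ⊢ (¬ᶠ f x)) → ∀ xs → s ⊢ (⋁ f xs ⇒ ⋁ f (filter P? xs))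
⋁-filter P? f ⊢¬f []       = infer [] λ _ → ⇒-intro id
⋁-filter P? f ⊢¬f (x ∷ xs) with P? x
... | yes _  = infer (⋁-filter P? f ⊢¬f xs ∷ []) λ
      { (rest ∷ []) → ⇒-intro λ ⊩⋁ →
          [ ∨-introˡ , ∨-introʳ ∘ ⇒-elim rest ]′ (∨-elim ⊩⋁) }
... | no ¬Px = infer (⋁-filter P? f ⊢¬f xs ∷ ⊢¬f ¬Px ∷ []) λ
      { (rest ∷ ¬fx ∷ []) → ⇒-intro λ ⊩⋁ →
          [ (λ fx → contradiction fx (¬-elim ¬fx)) , ⇒-elim rest ]′ (∨-elim ⊩⋁) }

module _ (B : Subset n) .(B≢∅ : Nonempty B) where

  D-mono : s ⊢ (φ ⇒ ψ) → s ⊢ (D B B≢∅ φ ⇒ D B B≢∅ ψ)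
  D-mono ⊢φ⇒ψ = mp (axK B B≢∅ _ _) (nec B B≢∅ ⊢φ⇒ψ)

  D-infer : ∀ {Θ} → All (λ θ → s ⊢ (γ ⇒ D B B≢∅ θ)) Θ →
            (∀ {v} → All (v ⊩_) Θ → v ⊩ φ) → s ⊢ (γ ⇒ D B B≢∅ φ)
  D-infer []          consequence = ⇒-const (nec B B≢∅ (infer [] consequence))
  D-infer {s = s} {γ = γ} {φ = φ} (_∷_ {θ} ⊢Dθ ⊢DΘ) consequence =
    infer (⊢Dθ ∷ ⊢D[θ⇒φ] ∷ axK B B≢∅ θ φ ∷ []) λ
      { (γ⇒Dθ ∷ γ⇒D[θ⇒φ] ∷ axKθφ ∷ []) → ⇒-intro λ γ →
          ⇒-elim (⇒-elim axKθφ (⇒-elim γ⇒D[θ⇒φ] γ)) (⇒-elim γ⇒Dθ γ) }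
    where
    ⊢D[θ⇒φ] : s ⊢ (γ ⇒ D B B≢∅ (θ ⇒ φ))
    ⊢D[θ⇒φ] = D-infer ⊢DΘ λ ⊩Θ → ⇒-intro λ ⊩θ → consequence (⊩θ ∷ ⊩Θ)

  D⇒D¬¬ : s ⊢ (D B B≢∅ φ ⇒ D B B≢∅ (¬ᶠ ¬ᶠ φ))
  D⇒D¬¬ = D-mono (infer [] λ _ → ⇒-intro λ φ → ¬-intro λ ¬φ → ¬-elim ¬φ φ)

  ax5 : ∀ φ → s ⊢ (¬ᶠ D B B≢∅ φ ⇒ D B B≢∅ (¬ᶠ D B B≢∅ φ))
  ax5 {s = s} φ = ⇒-trans (axB B B≢∅ (¬ᶠ D B B≢∅ φ)) (D-mono ¬D¬¬Dφ⇒¬Dφ)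
    where
    ¬D¬¬Dφ⇒¬Dφ : s ⊢ (¬ᶠ D B B≢∅ (¬ᶠ ¬ᶠ D B B≢∅ φ) ⇒ ¬ᶠ D B B≢∅ φ)
    ¬D¬¬Dφ⇒¬Dφ = infer (ax4 B B≢∅ φ ∷ D⇒D¬¬ ∷ []) λ
      { (Dφ⇒DDφ ∷ DDφ⇒D¬¬Dφ ∷ []) → ⇒-intro λ ¬D¬¬Dφ → ¬-intro λ Dφ →
          ¬-elim ¬D¬¬Dφ (⇒-elim DDφ⇒D¬¬Dφ (⇒-elim Dφ⇒DDφ Dφ)) }

  -- If D B φ but ¬ φ, then D B (D B ¬¬φ) by ax4 and D B (¬ D B ¬¬φ) by axB, hence D B ⊥.
  axT : ∀ φ → s ⊢ (aliveS B B≢∅ ⇒ (D B B≢∅ φ ⇒ φ))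
  axT {s = s} φ = infer (⊢D⊥ ∷ []) λ
      { (Dφ∧¬φ⇒D⊥ ∷ []) → ⇒-intro λ aliveB → ⇒-intro λ Dφ → ⊩-stable λ ⊮φ →
          ¬-elim aliveB (⇒-elim Dφ∧¬φ⇒D⊥ (∧-intro Dφ (¬-intro ⊮φ))) }
    where
    ⊢DD¬¬φ : s ⊢ (D B B≢∅ φ ∧ᶠ ¬ᶠ φ ⇒ D B B≢∅ (D B B≢∅ (¬ᶠ ¬ᶠ φ)))
    ⊢DD¬¬φ = infer (ax4 B B≢∅ φ ∷ D-mono D⇒D¬¬ ∷ []) λ
      { (Dφ⇒DDφ ∷ DDφ⇒DD¬¬φ ∷ []) → ⇒-intro (⇒-elim DDφ⇒DD¬¬φ ∘ ⇒-elim Dφ⇒DDφ ∘ ∧-elimˡ) }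

    ⊢D¬D¬¬φ : s ⊢ (D B B≢∅ φ ∧ᶠ ¬ᶠ φ ⇒ D B B≢∅ (¬ᶠ D B B≢∅ (¬ᶠ ¬ᶠ φ)))
    ⊢D¬D¬¬φ = infer (axB B B≢∅ (¬ᶠ φ) ∷ []) λ
      { (¬φ⇒D¬D¬¬φ ∷ []) → ⇒-intro (⇒-elim ¬φ⇒D¬D¬¬φ ∘ ∧-elimʳ) }

    ⊢D⊥ : s ⊢ (D B B≢∅ φ ∧ᶠ ¬ᶠ φ ⇒ D B B≢∅ ⊥ᶠ)
    ⊢D⊥ = D-infer (⊢DD¬¬φ ∷ ⊢D¬D¬¬φ ∷ []) λ
      { (D¬¬φ ∷ ¬D¬¬φ ∷ []) → contradiction D¬¬φ (¬-elim ¬D¬¬φ) }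

  ¬D⇒alive : ∀ {a} φ → a ∈ˢ B → s ⊢ (¬ᶠ D B B≢∅ φ ⇒ alive a)
  ¬D⇒alive {s = s} {a} φ a∈B = infer (⊢dead⇒D⊥ ∷ D-mono ⊢⊥⇒φ ∷ []) λ
    { (dead⇒D⊥ ∷ D⊥⇒Dφ ∷ []) → ⇒-intro λ ¬Dφ → ¬-intro λ dead →
        ¬-elim ¬Dφ (⇒-elim D⊥⇒Dφ (⇒-elim dead⇒D⊥ dead)) }
    where
    ⊢dead⇒D⊥ : s ⊢ (dead a ⇒ D B B≢∅ ⊥ᶠ)
    ⊢dead⇒D⊥ = axMono ⁅ a ⁆ B (a , x∈⁅x⁆ a) B≢∅ ⊥ᶠ (⁅⁆⊆ a∈B)

    ⊢⊥⇒φ : s ⊢ (⊥ᶠ ⇒ φ)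
    ⊢⊥⇒φ = infer [] λ _ → ⇒-intro λ ⊩⊥ → contradiction ⊩⊥ ⊮⊥

  ¬D⇒aliveAll : ∀ φ → s ⊢ (¬ᶠ D B B≢∅ φ ⇒ aliveAll B)
  ¬D⇒aliveAll φ = ⇒-⋀ (lookup B) alive (allFin n) λ {a} → ¬D⇒alive φ ∘ lookup⇒[]= a B

aliveAll⇒aliveS : ∀ (B : Subset n) .(B≢∅ : Nonempty B) → s ⊢ (aliveAll B ⇒ aliveS B B≢∅)
aliveAll⇒aliveS {n} {s} B B≢∅ =
  proj₂ (nonempty-induction AliveAll⇒AliveS singleton union B (recompute (nonempty? B) B≢∅))
  where
  AliveAll⇒AliveS : Subset n → Set
  AliveAll⇒AliveS B = ∃ λ (B≢∅ : Nonempty B) → s ⊢ (aliveAll B ⇒ aliveS B B≢∅)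

  singleton : ∀ a → AliveAll⇒AliveS ⁅ a ⁆
  singleton a = (a , x∈⁅x⁆ a) , infer [] λ _ → ⇒-intro λ ⊩aliveAll →
    ⋀ˢ-elim ⁅ a ⁆ alive ⊩aliveAll (x∈⁅x⁆ a)

  union : ∀ {B C} → AliveAll⇒AliveS B → AliveAll⇒AliveS C → AliveAll⇒AliveS (B ∪ C)
  union {B} {C} (B≢∅@(b , b∈B) , ⊢aliveB) (C≢∅ , ⊢aliveC) = (b , p⊆p∪q C b∈B) ,
    infer (⊢aliveB ∷ ⊢aliveC ∷ axUnion B C B≢∅ C≢∅ _ ∷ []) λ
      { (aliveB ∷ aliveC ∷ aliveB∪C ∷ []) → ⇒-intro λ ⊩aliveAll → ⇒-elim aliveB∪C (∧-intro
          (⇒-elim aliveB (⋀ˢ-intro B alive (⋀ˢ-elim (B ∪ C) alive ⊩aliveAll ∘ p⊆p∪q C)))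
          (⇒-elim aliveC (⋀ˢ-intro C alive (⋀ˢ-elim (B ∪ C) alive ⊩aliveAll ∘ q⊆p∪q B C)))) }

deadS-empty : ∀ (B : Subset n) → ¬ Nonempty B → s ⊢ deadS B
deadS-empty B empty = infer [] λ _ → ⋀ˢ-intro B dead λ a∈B → contradiction (_ , a∈B) empty

-- axMin and axMax exclude the set B of all agents, for which deadS (∁ B) is provable.

aliveAll∧deadS⇒D-deadS : ∀ (B : Subset n) .(B≢∅ : Nonempty B) →
                         min ⊢ (aliveAll B ∧ᶠ deadS (∁ B) ⇒ D B B≢∅ (deadS (∁ B)))
aliveAll∧deadS⇒D-deadS B B≢∅ with nonempty? (∁ B)
... | no empty = ⇒-const (nec B B≢∅ (deadS-empty (∁ B) empty))
... | yes ∁B≢∅ = infer (aliveAll⇒aliveS B B≢∅ ∷ axMin refl B B≢∅ ∁B≢∅ ∷ []) λ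
      { (aliveAll⇒alive ∷ axMinB ∷ []) → ⇒-intro λ exactlyB → ⇒-elim axMinB
          (∧-intro (⇒-elim aliveAll⇒alive (∧-elimˡ exactlyB)) (∧-elimʳ exactlyB)) }

aliveAll⇒¬D¬deadS : ∀ (B : Subset n) .(B≢∅ : Nonempty B) →
                    max ⊢ (aliveAll B ⇒ ¬ᶠ D B B≢∅ (¬ᶠ deadS (∁ B)))
aliveAll⇒¬D¬deadS B B≢∅ with nonempty? (∁ B)
... | yes ∁B≢∅ = ⇒-trans (aliveAll⇒aliveS B B≢∅) (axMax refl B B≢∅ ∁B≢∅)
... | no empty = infer (aliveAll⇒aliveS B B≢∅ ∷ D-mono B B≢∅ ¬deadS⇒⊥ ∷ []) λ
      { (aliveAll⇒alive ∷ D¬deadS⇒D⊥ ∷ []) → ⇒-intro λ ⊩aliveAll → ¬-intro λ D¬deadS →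
          ¬-elim (⇒-elim aliveAll⇒alive ⊩aliveAll) (⇒-elim D¬deadS⇒D⊥ D¬deadS) }
  where
  ¬deadS⇒⊥ : max ⊢ (¬ᶠ deadS (∁ B) ⇒ ⊥ᶠ)
  ¬deadS⇒⊥ = infer (deadS-empty (∁ B) empty ∷ []) λ
    { (⊩deadS ∷ []) → ⇒-intro λ ¬deadS → contradiction ⊩deadS (¬-elim ¬deadS) }

aliveAll∧deadS∧γ⇒D : ∀ (B : Subset n) .(B≢∅ : Nonempty B) γ →
                     s ⊢ (aliveAll B ∧ᶠ deadS (∁ B) ∧ᶠ γ ⇒ D B B≢∅ (deadS (∁ B) ⇒ γ))
aliveAll∧deadS∧γ⇒D B B≢∅ γ = infer (aliveAll⇒aliveS B B≢∅ ∷ axDead B B≢∅ γ ∷ []) λ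
  { (aliveAll⇒alive ∷ axDeadγ ∷ []) → ⇒-intro λ exactlyB∧γ → ⇒-elim axDeadγ
      (∧-intro (⇒-elim aliveAll⇒alive (∧-elimˡ exactlyB∧γ)) (∧-elimʳ exactlyB∧γ)) }

-- Pseudo-models

-- ∼[ B ] need not be the intersection of the ∼[ ⁅ a ⁆ ] with a ∈ B; unravelling makes it so.
record PseudoModel (n : ℕ) : Set₁ where
  field
    World           : Set
    living          : World → Subset n
    living-nonempty : ∀ w → Nonempty (living w)
    _∼[_]_          : World → Subset n → World → Set
    ∼-living        : ∀ {B w w′} → w ∼[ B ] w′ → B ⊆ˢ living w
    ∼-refl          : ∀ {B w} → B ⊆ˢ living w → w ∼[ B ] w
    ∼-sym           : ∀ {B w w′} → w ∼[ B ] w′ → w′ ∼[ B ] w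
    ∼-trans         : ∀ {B w w′ w″} → w ∼[ B ] w′ → w′ ∼[ B ] w″ → w ∼[ B ] w″
    ∼-mono          : ∀ {B C w w′} → C ⊆ˢ B → w ∼[ B ] w′ → w ∼[ C ] w′
    label           : World → ℕ → Set
    label-stable    : ∀ {w i} → Stable (label w i)
    label-preserved : ∀ {w w′ i} → w ∼[ living w ] w′ → living w′ ⊆ˢ living w →
                      label w i → label w′ i

  _⊨ᴾ_ : World → Form n → Set
  w ⊨ᴾ atom i   = label w i
  w ⊨ᴾ (¬ᶠ φ)   = ¬ w ⊨ᴾ φ
  w ⊨ᴾ (φ ∧ᶠ ψ) = w ⊨ᴾ φ × w ⊨ᴾ ψ
  w ⊨ᴾ D B _ φ  = ∀ w′ → w ∼[ B ] w′ → w′ ⊨ᴾ φ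

  FrameCondition : Variant → Set
  FrameCondition min = ∀ w w′ → w ∼[ living w ] w′ → living w′ ⊆ˢ living w
  FrameCondition max = ∀ B w → Nonempty B → B ⊆ˢ living w → ∃ λ w′ → w ∼[ B ] w′ × living w′ ⊆ˢ B

module Unravelling {n : ℕ} (P : PseudoModel n) (w₀ : PseudoModel.World P) where

  open PseudoModel P

  data Path : Set
  last : Path → World

  data Path where
    root : Path
    step : (p : Path) (B : Subset n) (w : World) → last p ∼[ B ] w → Path

  last root           = w₀
  last (step _ _ w _) = w

  Living : Path → Subset n
  Living p = living (last p)

  -- p and step p C w r share their a-coloured vertex exactly when a ∈ C. So the a-coloured
  -- vertex of p is represented by origin ⁅ a ⁆ p, the shortest prefix from which p is reached
  -- along edges whose labels contain a.
  origin : Subset n → Path → Path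
  origin B root = root
  origin B (step p C w r) with B ⊆ˢ? C
  ... | yes _ = origin B p
  ... | no  _ = step p C w r

  IsOrigin : Subset n → Path → Set
  IsOrigin B root           = ⊤
  IsOrigin B (step p C w r) = B ⊈ C

  isOrigin? : ∀ B p → Dec (IsOrigin B p)
  isOrigin? B root           = yes tt
  isOrigin? B (step p C w r) = ¬? (B ⊆ˢ? C)

  origin-isOrigin : ∀ B p → IsOrigin B (origin B p)
  origin-isOrigin B root = tt
  origin-isOrigin B (step p C w r) with B ⊆ˢ? C
  ... | yes _  = origin-isOrigin B p
  ... | no B⊈C = B⊈C

  isOrigin⇒origin≡ : ∀ {B} p → IsOrigin B p → origin B p ≡ p
  isOrigin⇒origin≡ root _ = refl
  isOrigin⇒origin≡ {B} (step p C w r) B⊈C with B ⊆ˢ? C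
  ... | yes B⊆C = ⊥-elim (B⊈C B⊆C)
  ... | no _    = refl

  isOrigin⇒root⊎∃ : ∀ {B} p → IsOrigin B p → p ≡ root ⊎ ∃ λ a → a ∈ˢ B × IsOrigin ⁅ a ⁆ p
  isOrigin⇒root⊎∃ root _ = inj₁ refl
  isOrigin⇒root⊎∃ {B} (step p C w r) B⊈C with ⊈⇒∃∉ B C B⊈C
  ... | a , a∈B , a∉C = inj₂ (a , a∈B , λ ⁅a⁆⊆C → a∉C (⁅a⁆⊆C (x∈⁅x⁆ a)))

  origin-step : ∀ {B C} p {w} (r : last p ∼[ C ] w) → B ⊆ˢ C → origin B (step p C w r) ≡ origin B p
  origin-step {B} {C} p r B⊆C with B ⊆ˢ? C
  ... | yes _  = refl
  ... | no B⊈C = ⊥-elim (B⊈C B⊆C)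

  origin-origin : ∀ {B C} p → C ⊆ˢ B → origin C (origin B p) ≡ origin C p
  origin-origin root C⊆B = refl
  origin-origin {B} (step p E w r) C⊆B with B ⊆ˢ? E
  ... | yes B⊆E = trans (origin-origin p C⊆B) (sym (origin-step p r (B⊆E ∘ C⊆B)))
  ... | no _    = refl

  last∼origin : ∀ {B} p → B ⊆ˢ Living p → last p ∼[ B ] last (origin B p)
  last∼origin root B⊆root = ∼-refl B⊆root
  last∼origin {B} (step p C w r) B⊆p with B ⊆ˢ? C
  ... | yes B⊆C = ∼-trans (∼-sym (∼-mono B⊆C r)) (last∼origin p (∼-living r ∘ B⊆C))
  ... | no _    = ∼-refl B⊆p

  origin-living : ∀ {a} p → a ∈ˢ Living p → a ∈ˢ Living (origin ⁅ a ⁆ p)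
  origin-living {a} p a∈p = ∼-living (∼-sym (last∼origin p (⁅⁆⊆ a∈p))) (x∈⁅x⁆ a)

  infix 4 _≼_

  data _≼_ : Path → Path → Set where
    ≼-refl : ∀ {p} → p ≼ p
    ≼-step : ∀ {p q B w r} → p ≼ q → p ≼ step q B w r

  root-≼ : ∀ p → root ≼ p
  root-≼ root           = ≼-refl
  root-≼ (step p _ _ _) = ≼-step (root-≼ p)

  origin-≼ : ∀ B p → origin B p ≼ p
  origin-≼ B root = ≼-refl
  origin-≼ B (step p C w r) with B ⊆ˢ? C
  ... | yes _ = ≼-step (origin-≼ B p)
  ... | no _  = ≼-refl

  depth : Path → ℕ
  depth root           = 0
  depth (step p _ _ _) = suc (depth p)

  depth-mono : ∀ {p q} → p ≼ q → depth p ≤ depth q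
  depth-mono ≼-refl       = ℕ.≤-refl
  depth-mono (≼-step p≼q) = ℕ.m≤n⇒m≤1+n (depth-mono p≼q)

  ≼-antisym : ∀ {p q} → p ≼ q → q ≼ p → p ≡ q
  ≼-antisym ≼-refl       _   = refl
  ≼-antisym (≼-step p≼q) q≼p = contradiction (depth-mono p≼q) (ℕ.<⇒≱ (depth-mono q≼p))

  SameOrigins : Subset n → Path → Path → Set
  SameOrigins B p q = ∀ {a} → a ∈ˢ B → origin ⁅ a ⁆ p ≡ origin ⁅ a ⁆ q

  -- origin B p is the root or the origin of p for a single a ∈ B.
  sameOrigins⇒≼ : ∀ {B} p q → SameOrigins B p q → origin B p ≼ origin B q
  sameOrigins⇒≼ {B} p q same with isOrigin⇒root⊎∃ (origin B p) (origin-isOrigin B p)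
  ... | inj₁ ≡root = subst (_≼ origin B q) (sym ≡root) (root-≼ (origin B q))
  ... | inj₂ (a , a∈B , isOrigin) =
        subst (_≼ origin B q) (sym origin-p≡) (origin-≼ ⁅ a ⁆ (origin B q))
    where
    open ≡-Reasoning
    origin-p≡ : origin B p ≡ origin ⁅ a ⁆ (origin B q)
    origin-p≡ = begin
      origin B p                ≡⟨ isOrigin⇒origin≡ (origin B p) isOrigin ⟨
      origin ⁅ a ⁆ (origin B p) ≡⟨ origin-origin p (⁅⁆⊆ a∈B) ⟩
      origin ⁅ a ⁆ p            ≡⟨ same a∈B ⟩
      origin ⁅ a ⁆ q            ≡⟨ origin-origin q (⁅⁆⊆ a∈B) ⟨
      origin ⁅ a ⁆ (origin B q) ∎

  sameOrigins⇒origin≡ : ∀ {B} p q → SameOrigins B p q → origin B p ≡ origin B q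
  sameOrigins⇒origin≡ p q same =
    ≼-antisym (sameOrigins⇒≼ p q same) (sameOrigins⇒≼ q p (sym ∘ same))

  sameOrigins⇒∼ : ∀ {B} p q → B ⊆ˢ Living p → B ⊆ˢ Living q → SameOrigins B p q →
                  last p ∼[ B ] last q
  sameOrigins⇒∼ {B} p q B⊆p B⊆q same = ∼-trans p∼origin-q (∼-sym (last∼origin q B⊆q))
    where
    p∼origin-q : last p ∼[ B ] last (origin B q)
    p∼origin-q =
      subst (λ o → last p ∼[ B ] last o) (sameOrigins⇒origin≡ p q same) (last∼origin p B⊆p)

  record Vertex : Set where
    constructor vertex
    field
      colour    : Fin n
      base      : Path
      .isOrigin : IsOrigin ⁅ colour ⁆ base
      .isLiving : colour ∈ˢ Living base

  open Vertex

  vertex-≡ : ∀ {u v} → colour u ≡ colour v → base u ≡ base v → u ≡ v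
  vertex-≡ refl refl = refl

  record verts (p : Path) (v : Vertex) : Set where
    constructor on
    field
      colour-living : colour v ∈ˢ Living p
      origin≡base   : origin ⁅ colour v ⁆ p ≡ base v

  open verts

  vertexAt : ∀ p {a} → a ∈ˢ Living p → Vertex
  vertexAt p {a} a∈p =
    vertex a (origin ⁅ a ⁆ p) (origin-isOrigin ⁅ a ⁆ p) (origin-living p a∈p)

  vertexAt∈verts : ∀ p {a} (a∈p : a ∈ˢ Living p) → verts p (vertexAt p a∈p)
  vertexAt∈verts p a∈p = on a∈p refl

  ∈verts-base : ∀ v → verts (base v) v
  ∈verts-base (vertex a p isOrigin isLiving) =
    on (recompute (a ∈ˢ? Living p) isLiving)
       (isOrigin⇒origin≡ p (recompute (isOrigin? ⁅ a ⁆ p) isOrigin))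

  verts-nonempty : ∀ p → NonEmptyP (verts p)
  verts-nonempty p =
    let _ , a∈p = living-nonempty (last p) in vertexAt p a∈p , vertexAt∈verts p a∈p

  verts-chromatic : ∀ p {u v} → verts p u → verts p v → colour u ≡ colour v → u ≡ v
  verts-chromatic p {u} {v} (on _ u-base) (on _ v-base) cu≡cv = vertex-≡ cu≡cv (begin
    base u                ≡⟨ u-base ⟨
    origin ⁅ colour u ⁆ p ≡⟨ cong (λ a → origin ⁅ a ⁆ p) cu≡cv ⟩
    origin ⁅ colour v ⁆ p ≡⟨ v-base ⟩
    base v                ∎)
    where open ≡-Reasoning

  verts-step : ∀ {C} p {w} (r : last p ∼[ C ] w) {v} → colour v ∈ˢ C →
               verts p v → verts (step p C w r) v
  verts-step p r c∈C (on _ v-base) =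
    on (∼-living (∼-sym r) c∈C) (trans (origin-step p r (⁅⁆⊆ c∈C)) v-base)

  verts-⊆⇒living-⊆ : ∀ p q → verts p ⊆ verts q → Living p ⊆ˢ Living q
  verts-⊆⇒living-⊆ p q p⊆q a∈p = colour-living (p⊆q (vertexAt∈verts p a∈p))

  verts-⊆⇒∼ : ∀ p q → verts p ⊆ verts q → last p ∼[ Living p ] last q
  verts-⊆⇒∼ p q p⊆q = sameOrigins⇒∼ p q id (verts-⊆⇒living-⊆ p q p⊆q) λ a∈p →
    sym (origin≡base (p⊆q (vertexAt∈verts p a∈p)))

  HasColour : Pred Vertex → Fin n → Set
  HasColour X a = ∃ λ v → X v × colour v ≡ a

  hasColour⇒∈ : ∀ {X} p → X ⊆ verts p → ∀ {v} → verts p v → HasColour X (colour v) → X v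
  hasColour⇒∈ {X} p X⊆p pv (u , Xu , cu≡cv) = subst X (verts-chromatic p (X⊆p Xu) pv cu≡cv) Xu

  record IsSimplex (X : Pred Vertex) : Set where
    constructor simplex
    field
      nonempty  : NonEmptyP X
      carrier   : Path
      ⊆-carrier : X ⊆ verts carrier

  simplex-resp-≐ : ∀ {X Y} → X ≐ Y → IsSimplex X → IsSimplex Y
  simplex-resp-≐ (X⊆Y , Y⊆X) (simplex (v , Xv) p X⊆p) =
    simplex (v , X⊆Y Xv) p λ Yv → X⊆p (Y⊆X Yv)

  verts-simplex : ∀ p → IsSimplex (verts p)
  verts-simplex p = simplex (verts-nonempty p) p id

  -- A simplex of the maximal model may have an undecidable set of colours, hence the
  -- double negation in world⇒¬¬verts.
  record WorldChoice : Set₁ where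
    field
      IsWorld       : Pred Vertex → Set
      world-resp-≐  : ∀ {X Y} → X ≐ Y → IsWorld X → IsWorld Y
      world⇒simplex : ∀ {X} → IsWorld X → IsSimplex X
      verts-world   : ∀ p → IsWorld (verts p)
      world⇒¬¬verts : ∀ {X} → IsWorld X → ¬ ¬ ∃ λ p → X ≐ verts p

  module Satisfaction (choice : WorldChoice) where

    open WorldChoice choice

    -- The double negation in the labelling makes satisfaction stable.
    model : Model n
    model = record
      { V           = Vertex
      ; χ           = colour
      ; S           = IsSimplex
      ; S-nonempty  = λ _ → IsSimplex.nonempty
      ; S-singleton = λ v → simplex (v , refl) (base v) λ { refl → ∈verts-base v }
      ; S-down      = λ { X Y (simplex _ p X⊆p) Y⊆X Y≢∅ → simplex Y≢∅ p λ Yv → X⊆p (Y⊆X Yv) }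
      ; chromatic   = λ { X (simplex _ p X⊆p) u v Xu Xv → verts-chromatic p (X⊆p Xu) (X⊆p Xv) }
      ; W           = IsWorld
      ; W-resp      = λ _ _ → world-resp-≐
      ; facet⊆W     = λ { X (simplex _ p X⊆p , maximal) → world-resp-≐
                        (maximal (verts p) (verts-simplex p) X⊆p , X⊆p) (verts-world p) }
      ; W⊆S         = λ _ → world⇒simplex
      ; ℓ           = λ X i → ¬ ¬ ∃ λ p → X ≐ verts p × label (last p) i
      ; ℓ-resp      = λ X Y i X≐Y → ¬¬-map λ { (p , X≐p , p-label) →
                        p , ≐-trans (≐-sym X≐Y) X≐p , p-label }
      }

    ⊨-stable : ∀ φ {X} → Stable (model , X ⊨ φ)
    ⊨-stable (atom i)  ¬¬⊨φ = lift (negated-stable (¬¬-map lower ¬¬⊨φ))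
    ⊨-stable (¬ᶠ φ)    ¬¬⊨φ = negated-stable ¬¬⊨φ
    ⊨-stable (φ ∧ᶠ ψ)  ¬¬⊨φ = ⊨-stable φ (¬¬-map proj₁ ¬¬⊨φ) , ⊨-stable ψ (¬¬-map proj₂ ¬¬⊨φ)
    ⊨-stable (D B _ φ) ¬¬⊨φ = λ X′ X′-world shared →
      ⊨-stable φ (¬¬-map (λ ⊨Dφ → ⊨Dφ X′ X′-world shared) ¬¬⊨φ)

    shared⇒∼ : ∀ {B X X′} p q → X ⊆ verts p → X′ ⊆ verts q →
               _⊆χ_∩_ {M = model} B X X′ → last p ∼[ B ] last q
    shared⇒∼ {B} p q X⊆p X′⊆q shared = sameOrigins⇒∼ p q B⊆p B⊆q same
      where
      B⊆p : B ⊆ˢ Living p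
      B⊆p a∈B with shared _ a∈B
      ... | _ , Xv , _ , refl = colour-living (X⊆p Xv)

      B⊆q : B ⊆ˢ Living q
      B⊆q a∈B with shared _ a∈B
      ... | _ , _ , X′v , refl = colour-living (X′⊆q X′v)

      same : SameOrigins B p q
      same a∈B with shared _ a∈B
      ... | _ , Xv , X′v , refl = trans (origin≡base (X⊆p Xv)) (sym (origin≡base (X′⊆q X′v)))

    step-shared : ∀ {B X} p {w} (r : last p ∼[ B ] w) → verts p ⊆ X →
                  _⊆χ_∩_ {M = model} B X (verts (step p B w r))
    step-shared p r p⊆X a a∈B =
      vertexAt p a∈p , p⊆X (vertexAt∈verts p a∈p) , verts-step p r a∈B (vertexAt∈verts p a∈p) , refl
      where
      a∈p : a ∈ˢ Living p
      a∈p = ∼-living r a∈B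

    verts-≐⇒label : ∀ {i} p q → verts p ≐ verts q → label (last q) i → label (last p) i
    verts-≐⇒label p q (p⊆q , q⊆p) =
      label-preserved (verts-⊆⇒∼ q p q⊆p) (verts-⊆⇒living-⊆ p q p⊆q)

    ⊨ᴾ⇒⊨ : ∀ φ p {X} → X ≐ verts p → last p ⊨ᴾ φ → model , X ⊨ φ
    ⊨⇒⊨ᴾ : ∀ φ p {X} → X ≐ verts p → model , X ⊨ φ → last p ⊨ᴾ φ

    ⊨ᴾ⇒⊨ (atom i)  p X≐p p-label   = lift (contradiction (p , X≐p , p-label))
    ⊨ᴾ⇒⊨ (¬ᶠ φ)    p X≐p p⊭φ X⊨φ   = p⊭φ (⊨⇒⊨ᴾ φ p X≐p X⊨φ)
    ⊨ᴾ⇒⊨ (φ ∧ᶠ ψ)  p X≐p (⊨φ , ⊨ψ) = ⊨ᴾ⇒⊨ φ p X≐p ⊨φ , ⊨ᴾ⇒⊨ ψ p X≐p ⊨ψ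
    ⊨ᴾ⇒⊨ (D B _ φ) p (X⊆p , _) p⊨Dφ X′ X′-world shared =
      ⊨-stable φ (¬¬-map (λ { (q , X′≐q@(X′⊆q , _)) →
        ⊨ᴾ⇒⊨ φ q X′≐q (p⊨Dφ (last q) (shared⇒∼ p q X⊆p X′⊆q shared)) }) (world⇒¬¬verts X′-world))

    ⊨⇒⊨ᴾ (atom i)  p X≐p (lift ¬¬label) = label-stable (¬¬-map
      (λ { (q , X≐q , q-label) → verts-≐⇒label p q (≐-trans (≐-sym X≐p) X≐q) q-label }) ¬¬label)
    ⊨⇒⊨ᴾ (¬ᶠ φ)    p X≐p X⊭φ p⊨φ   = X⊭φ (⊨ᴾ⇒⊨ φ p X≐p p⊨φ)
    ⊨⇒⊨ᴾ (φ ∧ᶠ ψ)  p X≐p (⊨φ , ⊨ψ) = ⊨⇒⊨ᴾ φ p X≐p ⊨φ , ⊨⇒⊨ᴾ ψ p X≐p ⊨ψ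
    ⊨⇒⊨ᴾ (D B _ φ) p (_ , p⊆X) X⊨Dφ w r =
      let q = step p B w r
      in ⊨⇒⊨ᴾ φ q ≐-refl (X⊨Dφ (verts q) (verts-world q) (step-shared p r p⊆X))

    everywhere⇒⊨ᴾ : ∀ φ → (∀ X → IsWorld X → model , X ⊨ φ) → w₀ ⊨ᴾ φ
    everywhere⇒⊨ᴾ φ everywhere = ⊨⇒⊨ᴾ φ root ≐-refl (everywhere (verts root) (verts-world root))

  pathWorlds : WorldChoice
  pathWorlds = record
    { IsWorld       = λ X → ∃ λ p → X ≐ verts p
    ; world-resp-≐  = λ { X≐Y (p , X≐p) → p , ≐-trans (≐-sym X≐Y) X≐p }
    ; world⇒simplex = λ { (p , X≐p) → simplex-resp-≐ (≐-sym X≐p) (verts-simplex p) }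
    ; verts-world   = λ p → p , ≐-refl
    ; world⇒¬¬verts = contradiction
    }

  pathWorlds-minimal : FrameCondition min → IsMinimal (Satisfaction.model pathWorlds)
  pathWorlds-minimal condition X X-world@(p , X⊆p , p⊆X) =
    WorldChoice.world⇒simplex pathWorlds X-world , maximal
    where
    maximal : ∀ Y → IsSimplex Y → X ⊆ Y → Y ⊆ X
    maximal Y (simplex _ q Y⊆q) X⊆Y {v} Yv = hasColour⇒∈ q (Y⊆q ∘ X⊆Y) (Y⊆q Yv)
      (vertexAt p c∈p , p⊆X (vertexAt∈verts p c∈p) , refl)
      where
      p⊆q : verts p ⊆ verts q
      p⊆q pv = Y⊆q (X⊆Y (p⊆X pv))

      c∈p : colour v ∈ˢ Living p
      c∈p = condition (last p) (last q) (verts-⊆⇒∼ p q p⊆q) (colour-living (Y⊆q Yv))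

  face≐verts-step : ∀ {B X} p {w} (r : last p ∼[ B ] w) → living w ⊆ˢ B → X ⊆ verts p →
                    (∀ a → a ∈ˢ B ⇔ HasColour X a) → X ≐ verts (step p B w r)
  face≐verts-step {B} {X} p {w} r w⊆B X⊆p colours = X⊆q , q⊆X
    where
    X⊆q : X ⊆ verts (step p B w r)
    X⊆q Xv = verts-step p r (Equivalence.from (colours _) (_ , Xv , refl)) (X⊆p Xv)

    q⊆X : verts (step p B w r) ⊆ X
    q⊆X qv = hasColour⇒∈ (step p B w r) X⊆q qv (Equivalence.to (colours _) (w⊆B (colour-living qv)))

  simplex⇒¬¬verts : FrameCondition max → ∀ {X} → IsSimplex X → ¬ ¬ ∃ λ p → X ≐ verts p
  simplex⇒¬¬verts condition {X} (simplex (x , Xx) p X⊆p) = ¬¬-map carriedExactly ¬¬-comprehension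
    where
    carriedExactly : (∃ λ B → ∀ a → a ∈ˢ B ⇔ HasColour X a) → ∃ λ q → X ≐ verts q
    carriedExactly (B , colours) =
      let w , r , w⊆B = condition B (last p) B≢∅ B⊆p
      in step p B w r , face≐verts-step p r w⊆B X⊆p colours
      where
      B≢∅ : Nonempty B
      B≢∅ = colour x , Equivalence.from (colours _) (x , Xx , refl)

      B⊆p : B ⊆ˢ Living p
      B⊆p a∈B with Equivalence.to (colours _) a∈B
      ... | _ , Xv , refl = colour-living (X⊆p Xv)

  simplexWorlds : FrameCondition max → WorldChoice
  simplexWorlds condition = record
    { IsWorld       = IsSimplex
    ; world-resp-≐  = simplex-resp-≐
    ; world⇒simplex = id
    ; verts-world   = verts-simplex
    ; world⇒¬¬verts = simplex⇒¬¬verts condition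
    }

  validMin⇒⊨ᴾ : FrameCondition min → ValidMin φ → w₀ ⊨ᴾ φ
  validMin⇒⊨ᴾ {φ = φ} condition valid = everywhere⇒⊨ᴾ φ (valid model (pathWorlds-minimal condition))
    where open Satisfaction pathWorlds

  validMax⇒⊨ᴾ : FrameCondition max → ValidMax φ → w₀ ⊨ᴾ φ
  validMax⇒⊨ᴾ {φ = φ} condition valid = everywhere⇒⊨ᴾ φ (valid model λ _ → id)
    where open Satisfaction (simplexWorlds condition)

Valid : Variant → Form n → Set₁
Valid min = ValidMin
Valid max = ValidMax

valid⇒⊨ᴾ : ∀ s (P : PseudoModel n) → PseudoModel.FrameCondition P s →
           Valid s φ → ∀ w → PseudoModel._⊨ᴾ_ P w φ
valid⇒⊨ᴾ min P condition valid w = Unravelling.validMin⇒⊨ᴾ P w condition valid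
valid⇒⊨ᴾ max P condition valid w = Unravelling.validMax⇒⊨ᴾ P w condition valid

-- Prime formulas and characteristic formulas

_≟ᶠ_ : DecidableEquality (Form n)
atom i ≟ᶠ atom j       = map′ (cong atom) (λ { refl → refl }) (i ℕ.≟ j)
atom _ ≟ᶠ (¬ᶠ _)       = no λ ()
atom _ ≟ᶠ (_ ∧ᶠ _)     = no λ ()
atom _ ≟ᶠ D _ _ _      = no λ ()
(¬ᶠ _) ≟ᶠ atom _       = no λ ()
(¬ᶠ φ) ≟ᶠ (¬ᶠ ψ)       = map′ (cong ¬ᶠ_) (λ { refl → refl }) (φ ≟ᶠ ψ)
(¬ᶠ _) ≟ᶠ (_ ∧ᶠ _)     = no λ ()
(¬ᶠ _) ≟ᶠ D _ _ _      = no λ ()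
(_ ∧ᶠ _) ≟ᶠ atom _     = no λ ()
(_ ∧ᶠ _) ≟ᶠ (¬ᶠ _)     = no λ ()
(φ ∧ᶠ ψ) ≟ᶠ (φ′ ∧ᶠ ψ′) = map′ (λ { (refl , refl) → refl }) (λ { refl → refl , refl })
                              (φ ≟ᶠ φ′ ×-dec ψ ≟ᶠ ψ′)
(_ ∧ᶠ _) ≟ᶠ D _ _ _    = no λ ()
D _ _ _ ≟ᶠ atom _      = no λ ()
D _ _ _ ≟ᶠ (¬ᶠ _)      = no λ ()
D _ _ _ ≟ᶠ (_ ∧ᶠ _)    = no λ ()
D B _ φ ≟ᶠ D C _ ψ     = map′ (λ { (refl , refl) → refl }) (λ { refl → refl , refl })
                              (≡-dec Bool._≟_ B C ×-dec φ ≟ᶠ ψ)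

primes : Form n → List (Form n)
primes (atom i)    = atom i ∷ []
primes (¬ᶠ φ)      = primes φ
primes (φ ∧ᶠ ψ)    = primes φ ++ primes ψ
primes (D B B≢∅ φ) = D B B≢∅ φ ∷ primes φ

IsPrime : Form n → Set
IsPrime {n} γ = ∀ (v : Valuation n) → evalB v γ ≡ v γ

primes-isPrime : (φ : Form n) → All IsPrime (primes φ)
primes-isPrime (atom i)  = (λ _ → refl) ∷ []
primes-isPrime (¬ᶠ φ)    = primes-isPrime φ
primes-isPrime (φ ∧ᶠ ψ)  = All.++⁺ (primes-isPrime φ) (primes-isPrime ψ)
primes-isPrime (D B _ φ) = (λ _ → refl) ∷ primes-isPrime φ

primes-trans : ∀ (φ : Form n) {γ δ} → γ ∈ primes φ → δ ∈ primes γ → δ ∈ primes φ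
primes-trans (atom i)  (here refl) δ∈γ = δ∈γ
primes-trans (¬ᶠ φ)    γ∈φ         δ∈γ = primes-trans φ γ∈φ δ∈γ
primes-trans (φ ∧ᶠ ψ)  γ∈φ∧ψ       δ∈γ with ∈-++⁻ (primes φ) γ∈φ∧ψ
... | inj₁ γ∈φ = ∈-++⁺ˡ (primes-trans φ γ∈φ δ∈γ)
... | inj₂ γ∈ψ = ∈-++⁺ʳ (primes φ) (primes-trans ψ γ∈ψ δ∈γ)
primes-trans (D B _ φ) (here refl) δ∈γ = δ∈γ
primes-trans (D B _ φ) (there γ∈φ) δ∈γ = there (primes-trans φ γ∈φ δ∈γ)

AgreeOn : List (Form n) → Valuation n → Valuation n → Set
AgreeOn Γ v w = All (λ γ → evalB v γ ≡ evalB w γ) Γ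

evalB-local : ∀ {v w : Valuation n} φ → AgreeOn (primes φ) v w → evalB v φ ≡ evalB w φ
evalB-local (atom i)  (v≡w ∷ []) = v≡w
evalB-local (¬ᶠ φ)    v≡w        = cong not (evalB-local φ v≡w)
evalB-local (φ ∧ᶠ ψ)  v≡w        =
  cong₂ _∧_ (evalB-local φ (All.++⁻ˡ _ v≡w)) (evalB-local ψ (All.++⁻ʳ (primes φ) v≡w))
evalB-local (D B _ φ) (v≡w ∷ _)  = v≡w

Closed : List (Form n) → Form n → Set
Closed Γ φ = All (_∈ Γ) (primes φ)

⊩-resp-AgreeOn : ∀ {Γ} {v w : Valuation n} → Closed Γ φ → AgreeOn Γ v w → v ⊩ φ → w ⊩ φ
⊩-resp-AgreeOn {φ = φ} closed v≡w (holds φ-true) =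
  holds (trans (sym (evalB-local φ (All.map (All.lookup v≡w) closed))) φ-true)

closed-⋀ : ∀ {A : Set ℓ₁} {Γ} (p : A → Bool) (f : A → Form n) →
           Closed Γ ⊤ᶠ → (∀ x → Closed Γ (f x)) → ∀ xs → Closed Γ (⋀ p f xs)
closed-⋀ p f ⊤-closed f-closed []       = ⊤-closed
closed-⋀ p f ⊤-closed f-closed (x ∷ xs) with p x
... | true  = All.++⁺ (f-closed x) (closed-⋀ p f ⊤-closed f-closed xs)
... | false = closed-⋀ p f ⊤-closed f-closed xs

closure : List (Form n) → List (Form n)
closure = concatMap primes

∈⇒closed : ∀ (φ : Form n) Δ → φ ∈ Δ → Closed (closure Δ) φ
∈⇒closed φ Δ φ∈Δ = All.tabulate λ γ∈φ → ∈-concatMap⁺ primes (lose φ∈Δ γ∈φ)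

closure-closed : ∀ Δ → γ ∈ closure Δ → Closed (closure Δ) γ
closure-closed Δ γ∈closure with find (∈-concatMap⁻ primes {xs = Δ} γ∈closure)
... | φ , φ∈Δ , γ∈φ = All.tabulate λ δ∈γ → All.lookup (∈⇒closed φ Δ φ∈Δ) (primes-trans φ γ∈φ δ∈γ)

closure-isPrime : (Δ : List (Form n)) → All IsPrime (closure Δ)
closure-isPrime Δ = All.concat⁺ (All.map⁺ (All.universal primes-isPrime Δ))

literal : Valuation n → Form n → Form n
literal w γ = if evalB w γ then γ else ¬ᶠ γ

literal-intro : ∀ {v} (w : Valuation n) γ → evalB v γ ≡ evalB w γ → v ⊩ literal w γ
literal-intro w γ v≡w with evalB w γ
... | true  = holds v≡w
... | false = holds (cong not v≡w)

literal-elim : ∀ {v} (w : Valuation n) γ → v ⊩ literal w γ → evalB v γ ≡ evalB w γ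
literal-elim w γ (holds literal-true) with evalB w γ
... | true  = literal-true
... | false = Bool.not-injective literal-true

characteristic : List (Form n) → Valuation n → Form n
characteristic Γ w = ⋀ (const true) (literal w) Γ

characteristic-intro : ∀ {Γ v} (w : Valuation n) → AgreeOn Γ v w → v ⊩ characteristic Γ w
characteristic-intro {Γ = Γ} w v≡w = ⋀-intro (const true) (literal w) Γ λ {γ} γ∈Γ _ →
  literal-intro w γ (All.lookup v≡w γ∈Γ)

characteristic-elim : ∀ {Γ v} (w : Valuation n) → v ⊩ characteristic Γ w → AgreeOn Γ v w
characteristic-elim w ⊩χ = All.tabulate λ {γ} γ∈Γ →
  literal-elim w γ (⋀-elim (const true) (literal w) ⊩χ γ∈Γ refl)

characteristic⇒literal : ∀ {Γ} (w : Valuation n) → γ ∈ Γ → s ⊢ (characteristic Γ w ⇒ literal w γ)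
characteristic⇒literal w γ∈Γ = infer [] λ _ → ⇒-intro λ ⊩χ →
  ⋀-elim (const true) (literal w) ⊩χ γ∈Γ refl

allValuations : List (Form n) → List (Valuation n)
allValuations = functionsOn _≟ᶠ_

⋁-allValuations : ∀ {Γ : List (Form n)} → All IsPrime Γ → s ⊢ ⋁ (characteristic Γ) (allValuations Γ)
⋁-allValuations {Γ = Γ} Γ-prime = infer [] λ {v} _ →
  let w , w∈ , v≡w = functionsOn-complete _≟ᶠ_ v Γ
  in ⋁-intro (characteristic Γ) w∈ (characteristic-intro w (agreeOn v≡w))
  where
  agreeOn : ∀ {v w} → All (λ γ → v γ ≡ w γ) Γ → AgreeOn Γ v w
  agreeOn {v} {w} v≡w =
    All.zipWith (λ { (γ-prime , vγ≡wγ) → trans (γ-prime v) (trans vγ≡wγ (sym (γ-prime w))) })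
                (Γ-prime , v≡w)

-- Elimination of refutable valuations

record Box (n : ℕ) : Set where
  constructor box
  field
    group      : Subset n
    .inhabited : Nonempty group
    body       : Form n

open Box

□ : Box n → Form n
□ (box B B≢∅ φ) = D B B≢∅ φ

boxes : List (Form n) → List (Box n)
boxes []              = []
boxes (D B B≢∅ φ ∷ Γ) = box B B≢∅ φ ∷ boxes Γ
boxes (_ ∷ Γ)         = boxes Γ

∈-boxes⁺ : ∀ (b : Box n) Γ → □ b ∈ Γ → b ∈ boxes Γ
∈-boxes⁺ _ (D _ _ _ ∷ Γ) (here refl) = here refl
∈-boxes⁺ _ (D _ _ _ ∷ Γ) (there □b∈) = there (∈-boxes⁺ _ Γ □b∈)
∈-boxes⁺ _ (atom _ ∷ Γ)  (there □b∈) = ∈-boxes⁺ _ Γ □b∈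
∈-boxes⁺ _ ((¬ᶠ _) ∷ Γ)  (there □b∈) = ∈-boxes⁺ _ Γ □b∈
∈-boxes⁺ _ (_ ∧ᶠ _ ∷ Γ)  (there □b∈) = ∈-boxes⁺ _ Γ □b∈

∈-boxes⁻ : ∀ (b : Box n) Γ → b ∈ boxes Γ → □ b ∈ Γ
∈-boxes⁻ _ (D _ _ _ ∷ Γ) (here refl) = here refl
∈-boxes⁻ _ (D _ _ _ ∷ Γ) (there b∈)  = there (∈-boxes⁻ _ Γ b∈)
∈-boxes⁻ _ (atom _ ∷ Γ)  b∈          = there (∈-boxes⁻ _ Γ b∈)
∈-boxes⁻ _ ((¬ᶠ _) ∷ Γ)  b∈          = there (∈-boxes⁻ _ Γ b∈)
∈-boxes⁻ _ (_ ∧ᶠ _ ∷ Γ)  b∈          = there (∈-boxes⁻ _ Γ b∈)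

literal-introspection : ∀ (w : Valuation n) b {B} .(B≢∅ : Nonempty B) → group b ⊆ˢ B →
                        s ⊢ (literal w (□ b) ⇒ D B B≢∅ (literal w (□ b)))
literal-introspection w (box C C≢∅ φ) {B} B≢∅ C⊆B with w (D C C≢∅ φ)
... | true  = ⇒-trans (ax4 C C≢∅ φ) (axMono C B C≢∅ B≢∅ _ C⊆B)
... | false = ⇒-trans (ax5 C C≢∅ φ) (axMono C B C≢∅ B≢∅ _ C⊆B)

deadBox : Fin n → Box n
deadBox a = box ⁅ a ⁆ (a , x∈⁅x⁆ a) ⊥ᶠ

module Indistinguishability {n : ℕ} (Γ : List (Form n)) where

  infix 4 _≃[_]_ _≃[_]?_

  record _≃[_]_ (w : Valuation n) (B : Subset n) (w′ : Valuation n) : Set where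
    constructor related
    field
      ≃-alive : B ⊆ˢ aliveSet w
      ≃-□     : ∀ b → □ b ∈ Γ → group b ⊆ˢ B → w (□ b) ≡ w′ (□ b)

  open _≃[_]_ public

  _≃[_]?_ : ∀ w B w′ → Dec (w ≃[ B ] w′)
  w ≃[ B ]? w′
    with B ⊆ˢ? aliveSet w
       | All.all? (λ b → (group b ⊆ˢ? B) →-dec (w (□ b) Bool.≟ w′ (□ b))) (boxes Γ)
  ... | yes B⊆w | yes same = yes (related B⊆w λ b □b∈Γ → All.lookup same (∈-boxes⁺ b Γ □b∈Γ))
  ... | no B⊈w  | _        = no λ w≃w′ → B⊈w (≃-alive w≃w′)
  ... | _       | no ¬same = no λ w≃w′ →
        ¬same (All.tabulate λ {b} b∈boxes → ≃-□ w≃w′ b (∈-boxes⁻ b Γ b∈boxes))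

  ≃-refl : ∀ {B w} → B ⊆ˢ aliveSet w → w ≃[ B ] w
  ≃-refl B⊆w = related B⊆w λ _ _ _ → refl

  ≃-trans : ∀ {B w w′ w″} → w ≃[ B ] w′ → w′ ≃[ B ] w″ → w ≃[ B ] w″
  ≃-trans w≃w′ w′≃w″ = related (≃-alive w≃w′) λ b □b∈Γ b⊆B →
    trans (≃-□ w≃w′ b □b∈Γ b⊆B) (≃-□ w′≃w″ b □b∈Γ b⊆B)

  ≃-mono : ∀ {B C w w′} → C ⊆ˢ B → w ≃[ B ] w′ → w ≃[ C ] w′
  ≃-mono C⊆B w≃w′ = related (≃-alive w≃w′ ∘ C⊆B) λ b □b∈Γ b⊆C → ≃-□ w≃w′ b □b∈Γ (C⊆B ∘ b⊆C)

  ≃-sym : (∀ a → dead a ∈ Γ) → ∀ {B w w′} → w ≃[ B ] w′ → w′ ≃[ B ] w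
  ≃-sym dead∈Γ {B} {w} {w′} w≃w′ = related B⊆w′ λ b □b∈Γ b⊆B → sym (≃-□ w≃w′ b □b∈Γ b⊆B)
    where
    open ≡-Reasoning
    B⊆w′ : B ⊆ˢ aliveSet w′
    B⊆w′ {a} a∈B = ∈-aliveSet⁺ {w = w′} (holds (begin
      not (w′ (dead a)) ≡⟨ cong not (≃-□ w≃w′ (deadBox a) (dead∈Γ a) (⁅⁆⊆ a∈B)) ⟨
      not (w (dead a))  ≡⟨ evaluates (∈-aliveSet⁻ {w = w} (≃-alive w≃w′ a∈B)) ⟩
      true              ∎))

  Witness : Valuation n → Box n → Valuation n → Set
  Witness w b w′ = w ≃[ group b ] w′ × w′ ⊩ ¬ᶠ body b

  witness? : ∀ w b w′ → Dec (Witness w b w′)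
  witness? w b w′ = (w ≃[ group b ]? w′) ×-dec (w′ ⊩? ¬ᶠ body b)

  -- At w, the group of b knows the truth values of all □ c ∈ Γ with group c ⊆ group b, and
  -- that one of the valuations in xs is the actual one.
  unwitnessed⇒□ : ∀ {xs w} b → s ⊢ ⋁ (characteristic Γ) xs → Closed Γ (body b) →
                  group b ⊆ˢ aliveSet w → ¬ Any (Witness w b) xs → s ⊢ (characteristic Γ w ⇒ □ b)
  unwitnessed⇒□ {s = s} {xs} {w} (box B B≢∅ φ) ⊢⋁χ φ-closed B⊆w unwitnessed =
    D-infer B B≢∅ (⇒-const (nec B B≢∅ ⊢⋁χ) ∷ ⊢D-known) known⇒φ
    where
    ⊆B? : ∀ c → Dec (group c ⊆ˢ B)
    ⊆B? c = group c ⊆ˢ? B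

    known : List (Form n)
    known = map (literal w ∘ □) (filter ⊆B? (boxes Γ))

    ⊢D-known : All (λ θ → s ⊢ (characteristic Γ w ⇒ D B B≢∅ θ)) known
    ⊢D-known = All.map⁺ (All.tabulate λ {c} c∈filter →
      let c∈boxes , c⊆B = ∈-filter⁻ ⊆B? {xs = boxes Γ} c∈filter
      in ⇒-trans (characteristic⇒literal w (∈-boxes⁻ c Γ c∈boxes))
                 (literal-introspection w c B≢∅ c⊆B))

    known⇒≃ : ∀ {v w′} → All (v ⊩_) known → AgreeOn Γ v w′ → w ≃[ B ] w′
    known⇒≃ {v} {w′} ⊩known v≡w′ = related B⊆w λ c □c∈Γ c⊆B →
      let c∈filter = ∈-filter⁺ ⊆B? (∈-boxes⁺ c Γ □c∈Γ) c⊆B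
      in begin
        w (□ c)       ≡⟨ literal-elim w (□ c) (All.lookup (All.map⁻ ⊩known) c∈filter) ⟨
        evalB v (□ c) ≡⟨ All.lookup v≡w′ □c∈Γ ⟩
        w′ (□ c)      ∎
      where open ≡-Reasoning

    known⇒φ : ∀ {v} → All (v ⊩_) (⋁ (characteristic Γ) xs ∷ known) → v ⊩ φ
    known⇒φ (⊩⋁χ ∷ ⊩known) = ⊩-stable λ ⊮φ →
      let w′ , w′∈xs , ⊩χ = ⋁-elim (characteristic Γ) xs ⊩⋁χ
          v≡w′            = characteristic-elim w′ ⊩χ
          w′⊩¬φ           = ⊩-resp-AgreeOn φ-closed v≡w′ (¬-intro ⊮φ)
      in unwitnessed (lose w′∈xs (known⇒≃ ⊩known v≡w′ , w′⊩¬φ))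

variantBox : Variant → (B : Subset n) → .(Nonempty B) → Box n
variantBox min B B≢∅ = box B B≢∅ (deadS (∁ B))
variantBox max B B≢∅ = box B B≢∅ (¬ᶠ deadS (∁ B))

variantAxiom : Variant → (B : Subset n) → .(Nonempty B) → Form n
variantAxiom min B B≢∅ = aliveAll B ∧ᶠ deadS (∁ B) ⇒ □ (variantBox min B B≢∅)
variantAxiom max B B≢∅ = aliveAll B ⇒ ¬ᶠ □ (variantBox max B B≢∅)

⊢variantAxiom : ∀ s (B : Subset n) .(B≢∅ : Nonempty B) → s ⊢ variantAxiom s B B≢∅
⊢variantAxiom min = aliveAll∧deadS⇒D-deadS
⊢variantAxiom max = aliveAll⇒¬D¬deadS

variantBox∈primes : ∀ s (B : Subset n) .(B≢∅ : Nonempty B) →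
                    □ (variantBox s B B≢∅) ∈ primes (variantAxiom s B B≢∅)
variantBox∈primes min B _ = ∈-++⁺ʳ (primes (aliveAll B ∧ᶠ deadS (∁ B))) (here refl)
variantBox∈primes max B _ = ∈-++⁺ʳ (primes (aliveAll B)) (here refl)

faceBox : (B : Subset n) → .(Nonempty B) → Form n → Box n
faceBox B B≢∅ γ = box B B≢∅ (deadS (∁ B) ⇒ γ)

faceAxiom : (B : Subset n) → .(Nonempty B) → Form n → Form n
faceAxiom B B≢∅ γ = aliveAll B ∧ᶠ deadS (∁ B) ∧ᶠ γ ⇒ □ (faceBox B B≢∅ γ)

boxAxioms : Box n → List (Form n)
boxAxioms b = (aliveAll (group b) ⇒ (□ b ⇒ body b)) ∷ (¬ᶠ □ b ⇒ aliveAll (group b)) ∷ []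

⊢boxAxioms : ∀ (b : Box n) → All (s ⊢_) (boxAxioms b)
⊢boxAxioms (box B B≢∅ φ) =
  ⇒-trans (aliveAll⇒aliveS B B≢∅) (axT B B≢∅ φ) ∷ ¬D⇒aliveAll B B≢∅ φ ∷ []

module Elimination {n : ℕ} (s : Variant) (φ₀ : Form n) where

  open DecMembership (_≟ᶠ_ {n}) using (_∈?_)

  faceAxioms : ∃ (Nonempty {n}) → List (Form n)
  faceAxioms (B , B≢∅) = variantAxiom s B B≢∅ ∷ map (faceAxiom B B≢∅) (primes φ₀)

  worldAxioms : List (Form n)
  worldAxioms = someAlive ∷ concatMap faceAxioms (nonemptySubsets n)

  seeds : List (Form n)
  seeds = φ₀ ∷ ⊤ᶠ ∷ map dead (allFin n) ++ worldAxioms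

  Γ : List (Form n)
  Γ = closure seeds

  axioms : List (Form n)
  axioms = worldAxioms ++ concatMap boxAxioms (boxes Γ)

  ⊢axioms : All (s ⊢_) axioms
  ⊢axioms = All.++⁺
    (axAlive ∷ All.concat⁺ (All.map⁺ (All.universal ⊢faceAxioms (nonemptySubsets n))))
    (All.concat⁺ (All.map⁺ (All.universal ⊢boxAxioms (boxes Γ))))
    where
    ⊢faceAxioms : ∀ B → All (s ⊢_) (faceAxioms B)
    ⊢faceAxioms (B , B≢∅) =
      ⊢variantAxiom s B B≢∅ ∷ All.map⁺ (All.universal (aliveAll∧deadS∧γ⇒D B B≢∅) (primes φ₀))

  variantAxiom∈ : ∀ B .(B≢∅ : Nonempty B) → variantAxiom s B B≢∅ ∈ worldAxioms
  variantAxiom∈ B B≢∅ =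
    let _ , B∈ = ∈-nonemptySubsets B (recompute (nonempty? B) B≢∅)
    in there (∈-concatMap⁺ faceAxioms (lose B∈ (here refl)))

  faceAxiom∈ : ∀ B .(B≢∅ : Nonempty B) → γ ∈ primes φ₀ → faceAxiom B B≢∅ γ ∈ worldAxioms
  faceAxiom∈ B B≢∅ γ∈φ₀ =
    let _ , B∈ = ∈-nonemptySubsets B (recompute (nonempty? B) B≢∅)
    in there (∈-concatMap⁺ faceAxioms (lose B∈ (there (∈-map⁺ (faceAxiom B B≢∅) γ∈φ₀))))

  Γ-closed : γ ∈ Γ → Closed Γ γ
  Γ-closed = closure-closed seeds

  φ₀-closed : Closed Γ φ₀
  φ₀-closed = ∈⇒closed φ₀ seeds (here refl)

  worldAxiom-closed : ∀ {α} → α ∈ worldAxioms → Closed Γ α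
  worldAxiom-closed {α} α∈ = ∈⇒closed α seeds (there (there (∈-++⁺ʳ (map dead (allFin n)) α∈)))

  dead∈Γ : ∀ a → dead a ∈ Γ
  dead∈Γ a = All.head (∈⇒closed (dead a) seeds (there (there (∈-++⁺ˡ (∈-map⁺ dead (∈-allFin a))))))

  variantBox∈Γ : ∀ B .(B≢∅ : Nonempty B) → □ (variantBox s B B≢∅) ∈ Γ
  variantBox∈Γ B B≢∅ =
    All.lookup (worldAxiom-closed (variantAxiom∈ B B≢∅)) (variantBox∈primes s B B≢∅)

  faceBox∈Γ : ∀ B .(B≢∅ : Nonempty B) → γ ∈ primes φ₀ → □ (faceBox B B≢∅ γ) ∈ Γ
  faceBox∈Γ {γ} B B≢∅ γ∈φ₀ =
    All.lookup (worldAxiom-closed (faceAxiom∈ B B≢∅ γ∈φ₀))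
               (∈-++⁺ʳ (primes (aliveAll B ∧ᶠ deadS (∁ B) ∧ᶠ γ)) (here refl))

  aliveAll-closed : ∀ B → Closed Γ (aliveAll B)
  aliveAll-closed B = closed-⋀ (lookup B) alive ⊤-closed (λ a → Γ-closed (dead∈Γ a)) (allFin n)
    where
    ⊤-closed : Closed Γ ⊤ᶠ
    ⊤-closed = ∈⇒closed ⊤ᶠ seeds (there (here refl))

  boxAxioms-closed : ∀ b → □ b ∈ Γ → All (Closed Γ) (boxAxioms b)
  boxAxioms-closed b@(box B _ φ) □b∈Γ =
    All.++⁺ (aliveAll-closed B) (All.++⁺ □b-closed (All.tail □b-closed)) ∷
    All.++⁺ □b-closed (aliveAll-closed B) ∷ []
    where
    □b-closed : Closed Γ (□ b)
    □b-closed = Γ-closed □b∈Γ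

  axioms-closed : All (Closed Γ) axioms
  axioms-closed = All.++⁺ (All.tabulate worldAxiom-closed) (All.concat⁺ (All.map⁺
    (All.tabulate λ {b} b∈boxes → boxAxioms-closed b (∈-boxes⁻ b Γ b∈boxes))))

  open Indistinguishability Γ

  Sound : Valuation n → Set
  Sound w = All (w ⊩_) axioms

  Fulfilled : List (Valuation n) → Valuation n → Box n → Set
  Fulfilled xs w b = w ⊩ ¬ᶠ □ b → Any (Witness w b) xs

  Viable : List (Valuation n) → Valuation n → Set
  Viable xs w = Sound w × All (Fulfilled xs w) (boxes Γ)

  fulfilled? : ∀ xs w b → Dec (Fulfilled xs w b)
  fulfilled? xs w b = (w ⊩? ¬ᶠ □ b) →-dec Any.any? (witness? w b) xs

  viable? : ∀ xs w → Dec (Viable xs w)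
  viable? xs w = All.all? (w ⊩?_) axioms ×-dec All.all? (fulfilled? xs w) (boxes Γ)

  module _ {w : Valuation n} (sound : Sound w) where

    worldAxiom-holds : ∀ {α} → α ∈ worldAxioms → w ⊩ α
    worldAxiom-holds = All.lookup (All.++⁻ˡ worldAxioms sound)

    boxAxioms-hold : ∀ b → □ b ∈ Γ → All (w ⊩_) (boxAxioms b)
    boxAxioms-hold b □b∈Γ =
      All.lookup (All.map⁻ (All.concat⁻ (All.++⁻ʳ worldAxioms sound))) (∈-boxes⁺ b Γ □b∈Γ)

    aliveSet-nonempty : Nonempty (aliveSet w)
    aliveSet-nonempty =
      let a , _ , ⊩alive = ⋁-elim alive (allFin n) (worldAxiom-holds (here refl))
      in a , ∈-aliveSet⁺ ⊩alive

    □-elim : ∀ b → □ b ∈ Γ → group b ⊆ˢ aliveSet w → w ⊩ □ b → w ⊩ body b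
    □-elim b □b∈Γ b⊆w ⊩□b with boxAxioms-hold b □b∈Γ
    ... | alive⇒□⇒body ∷ _ = ⇒-elim (⇒-elim alive⇒□⇒body (⊆aliveSet⇒aliveAll b⊆w)) ⊩□b

    ¬□⇒⊆aliveSet : ∀ b → □ b ∈ Γ → w ⊩ ¬ᶠ □ b → group b ⊆ˢ aliveSet w
    ¬□⇒⊆aliveSet b □b∈Γ ⊩¬□b with boxAxioms-hold b □b∈Γ
    ... | _ ∷ ¬□⇒alive ∷ [] = aliveAll⇒⊆aliveSet (⇒-elim ¬□⇒alive ⊩¬□b)

  Refutable : Valuation n → Set
  Refutable w = s ⊢ (¬ᶠ characteristic Γ w)

  Exhaustive : List (Valuation n) → Set
  Exhaustive xs = s ⊢ ⋁ (characteristic Γ) xs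

  unsound⇒refutable : ∀ {w} → ¬ Sound w → Refutable w
  unsound⇒refutable {w} unsound = infer ⊢axioms λ ⊩axioms → ¬-intro λ ⊩χ →
    unsound (All.zipWith
      (λ { (α-closed , ⊩α) → ⊩-resp-AgreeOn α-closed (characteristic-elim w ⊩χ) ⊩α })
      (axioms-closed , ⊩axioms))

  unfulfilled⇒refutable : ∀ {xs w} b → Exhaustive xs → Sound w → □ b ∈ Γ →
                          ¬ Fulfilled xs w b → Refutable w
  unfulfilled⇒refutable {xs} {w} b exhaustive sound □b∈Γ unfulfilled = infer (⊢χ⇒□b ∷ []) λ
    { (χ⇒□b ∷ []) → ¬-intro λ ⊩χ → ¬-elim ⊩¬□b
        (⊩-resp-AgreeOn (Γ-closed □b∈Γ) (characteristic-elim w ⊩χ) (⇒-elim χ⇒□b ⊩χ)) }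
    where
    ⊩¬□b : w ⊩ ¬ᶠ □ b
    ⊩¬□b = ⊩-stable λ ⊮¬□b → unfulfilled λ ⊩¬□b → contradiction ⊩¬□b ⊮¬□b

    ⊢χ⇒□b : s ⊢ (characteristic Γ w ⇒ □ b)
    ⊢χ⇒□b = unwitnessed⇒□ b exhaustive (All.tail (Γ-closed □b∈Γ)) (¬□⇒⊆aliveSet sound b □b∈Γ ⊩¬□b)
              λ witness → unfulfilled λ _ → witness

  unviable⇒refutable : ∀ {xs w} → Exhaustive xs → ¬ Viable xs w → Refutable w
  unviable⇒refutable {xs} {w} exhaustive unviable
    with All.all? (w ⊩?_) axioms | All.all? (fulfilled? xs w) (boxes Γ)
  ... | no unsound | _             = unsound⇒refutable unsound
  ... | yes sound  | yes fulfilled = contradiction (sound , fulfilled) unviable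
  ... | yes sound  | no unfulfilled =
        let b , b∈boxes , b-unfulfilled =
              find (All.¬All⇒Any¬ (fulfilled? xs w) (boxes Γ) unfulfilled)
        in unfulfilled⇒refutable b exhaustive sound (∈-boxes⁻ b Γ b∈boxes) b-unfulfilled

  exhaustive-viable : ∃ λ xs → Exhaustive xs × All (Viable xs) xs
  exhaustive-viable = filter-fixpoint viable? Exhaustive
    (λ {xs} exhaustive →
      mp (⋁-filter (viable? xs) (characteristic Γ) (unviable⇒refutable exhaustive) xs) exhaustive)
    (allValuations Γ) (⋁-allValuations (closure-isPrime seeds))

  ≃-necessity : ∀ {w w′} b → Sound w′ → □ b ∈ Γ → w ≃[ group b ] w′ → w ⊩ □ b → w′ ⊩ body b
  ≃-necessity b sound′ □b∈Γ w≃w′ (holds □b-true) =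
    □-elim sound′ b □b∈Γ (≃-alive (≃-sym dead∈Γ w≃w′))
           (holds (trans (sym (≃-□ w≃w′ b □b∈Γ id)) □b-true))

  ≃-face : ∀ {w w′} → Sound w → Sound w′ → w ≃[ aliveSet w ] w′ → aliveSet w′ ⊆ˢ aliveSet w →
           γ ∈ primes φ₀ → w ⊩ γ → w′ ⊩ γ
  ≃-face {γ} {w} sound sound′ w≃w′ w′⊆w γ∈φ₀ ⊩γ = ⇒-elim
    (≃-necessity (faceBox B B≢∅ γ) sound′ (faceBox∈Γ B B≢∅ γ∈φ₀) w≃w′ ⊩faceBox)
    (aliveSet⊆⇒deadS-∁ w′⊆w)
    where
    B : Subset n
    B = aliveSet w

    B≢∅ : Nonempty B
    B≢∅ = aliveSet-nonempty sound

    ⊩faceBox : w ⊩ □ (faceBox B B≢∅ γ)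
    ⊩faceBox = ⇒-elim (worldAxiom-holds sound (faceAxiom∈ B B≢∅ γ∈φ₀))
      (∧-intro (⊆aliveSet⇒aliveAll id) (∧-intro (aliveSet⊆⇒deadS-∁ id) ⊩γ))

  module Survivors {xs : List (Valuation n)} (viable : All (Viable xs) xs) where

    sound : ∀ {w} → w ∈ xs → Sound w
    sound w∈xs = proj₁ (All.lookup viable w∈xs)

    witness : ∀ {w} → w ∈ xs → ∀ b → □ b ∈ Γ → w ⊩ ¬ᶠ □ b → ∃ λ w′ → w′ ∈ xs × Witness w b w′
    witness w∈xs b □b∈Γ ⊩¬□b =
      find (All.lookup (proj₂ (All.lookup viable w∈xs)) (∈-boxes⁺ b Γ □b∈Γ) ⊩¬□b)

    pseudoModel : PseudoModel n
    pseudoModel = record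
      { World           = ∃ (_∈ xs)
      ; living          = λ (w , _) → aliveSet w
      ; living-nonempty = λ (_ , w∈xs) → aliveSet-nonempty (sound w∈xs)
      ; _∼[_]_          = λ (w , _) B (w′ , _) → w ≃[ B ] w′
      ; ∼-living        = ≃-alive
      ; ∼-refl          = ≃-refl
      ; ∼-sym           = ≃-sym dead∈Γ
      ; ∼-trans         = ≃-trans
      ; ∼-mono          = ≃-mono
      ; label           = λ (w , _) i → atom i ∈ primes φ₀ × w ⊩ atom i
      ; label-stable    = decidable-stable ((_ ∈? primes φ₀) ×-dec (_ ⊩? _))
      ; label-preserved = λ { {_ , w∈xs} {_ , w′∈xs} w≃w′ w′⊆w (i∈φ₀ , ⊩i) →
          i∈φ₀ , ≃-face (sound w∈xs) (sound w′∈xs) w≃w′ w′⊆w i∈φ₀ ⊩i }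
      }

    open PseudoModel pseudoModel using (World; _⊨ᴾ_; FrameCondition)

    ⊩⇒⊨ᴾ : ∀ φ → Closed (primes φ₀) φ → ∀ (w : World) → proj₁ w ⊩ φ → w ⊨ᴾ φ
    ⊨ᴾ⇒⊩ : ∀ φ → Closed (primes φ₀) φ → ∀ (w : World) → w ⊨ᴾ φ → proj₁ w ⊩ φ

    ⊩⇒⊨ᴾ (atom i)  (i∈φ₀ ∷ []) w ⊩i     = i∈φ₀ , ⊩i
    ⊩⇒⊨ᴾ (¬ᶠ φ)    φ⊆φ₀        w ⊩¬φ ⊨φ = ¬-elim ⊩¬φ (⊨ᴾ⇒⊩ φ φ⊆φ₀ w ⊨φ)
    ⊩⇒⊨ᴾ (φ ∧ᶠ ψ)  φψ⊆φ₀       w ⊩φ∧ψ   =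
      ⊩⇒⊨ᴾ φ (All.++⁻ˡ _ φψ⊆φ₀) w (∧-elimˡ ⊩φ∧ψ) ,
      ⊩⇒⊨ᴾ ψ (All.++⁻ʳ (primes φ) φψ⊆φ₀) w (∧-elimʳ ⊩φ∧ψ)
    ⊩⇒⊨ᴾ (D B _ φ) (D∈φ₀ ∷ φ⊆φ₀) w ⊩D w′@(_ , w′∈xs) w≃w′ = ⊩⇒⊨ᴾ φ φ⊆φ₀ w′
      (≃-necessity (box B _ φ) (sound w′∈xs) (All.lookup φ₀-closed D∈φ₀) w≃w′ ⊩D)

    ⊨ᴾ⇒⊩ (atom i)    _     w (_ , ⊩i)  = ⊩i
    ⊨ᴾ⇒⊩ (¬ᶠ φ)      φ⊆φ₀  w ⊭φ        = ¬-intro (⊭φ ∘ ⊩⇒⊨ᴾ φ φ⊆φ₀ w)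
    ⊨ᴾ⇒⊩ (φ ∧ᶠ ψ)    φψ⊆φ₀ w (⊨φ , ⊨ψ) =
      ∧-intro (⊨ᴾ⇒⊩ φ (All.++⁻ˡ _ φψ⊆φ₀) w ⊨φ) (⊨ᴾ⇒⊩ ψ (All.++⁻ʳ (primes φ) φψ⊆φ₀) w ⊨ψ)
    ⊨ᴾ⇒⊩ (D B B≢∅ φ) (D∈φ₀ ∷ φ⊆φ₀) w@(_ , w∈xs) ⊨D = ⊩-stable λ ⊮D →
      let w′ , w′∈xs , w≃w′ , ⊩¬φ =
            witness w∈xs (box B B≢∅ φ) (All.lookup φ₀-closed D∈φ₀) (¬-intro ⊮D)
      in ¬-elim ⊩¬φ (⊨ᴾ⇒⊩ φ φ⊆φ₀ (w′ , w′∈xs) (⊨D (w′ , w′∈xs) w≃w′))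

    frameCondition : FrameCondition s
    frameCondition = fromAxiom s variantBox∈Γ λ w∈xs B B≢∅ →
      worldAxiom-holds (sound w∈xs) (variantAxiom∈ B B≢∅)
      where
      fromAxiom : ∀ t → (∀ B .(B≢∅ : Nonempty B) → □ (variantBox t B B≢∅) ∈ Γ) →
                  (∀ {w} → w ∈ xs → ∀ B .(B≢∅ : Nonempty B) → w ⊩ variantAxiom t B B≢∅) →
                  FrameCondition t
      fromAxiom min box∈Γ axiom (w , w∈xs) (w′ , w′∈xs) w≃w′ = deadS-∁⇒aliveSet⊆
        (≃-necessity (variantBox min (aliveSet w) w≢∅) (sound w′∈xs) (box∈Γ _ w≢∅) w≃w′
          (⇒-elim (axiom w∈xs _ w≢∅) (∧-intro (⊆aliveSet⇒aliveAll id) (aliveSet⊆⇒deadS-∁ id))))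
        where
        w≢∅ : Nonempty (aliveSet w)
        w≢∅ = aliveSet-nonempty (sound w∈xs)
      fromAxiom max box∈Γ axiom B (w , w∈xs) B≢∅ B⊆w =
        let w′ , w′∈xs , w≃w′ , ¬¬deadS =
              witness w∈xs (variantBox max B B≢∅) (box∈Γ B B≢∅)
                (⇒-elim (axiom w∈xs B B≢∅) (⊆aliveSet⇒aliveAll B⊆w))
        in (w′ , w′∈xs) , w≃w′ , deadS-∁⇒aliveSet⊆ (¬¬-elim ¬¬deadS)

Countermodel : Variant → Form n → Set₁
Countermodel {n} s φ = ∃ λ (P : PseudoModel n) →
  PseudoModel.FrameCondition P s × ∃ λ w → ¬ PseudoModel._⊨ᴾ_ P w φ

⊢⊎countermodel : ∀ s (φ : Form n) → s ⊢ φ ⊎ Countermodel s φ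
⊢⊎countermodel s φ with Elimination.exhaustive-viable s φ
... | xs , exhaustive , viable with All.all? (_⊩? φ) xs
...   | yes xs⊩φ = inj₁ (infer (exhaustive ∷ []) λ { (⊩⋁χ ∷ []) →
          let w , w∈xs , ⊩χ = ⋁-elim (characteristic Γ) xs ⊩⋁χ
              w≡v             = All.map sym (characteristic-elim w ⊩χ)
          in ⊩-resp-AgreeOn φ₀-closed w≡v (All.lookup xs⊩φ w∈xs) })
  where open Elimination s φ
...   | no xs⊮φ =
          let w , w∈xs , ⊮φ = find (All.¬All⇒Any¬ (_⊩? φ) xs xs⊮φ)
          in inj₂ (pseudoModel , frameCondition , (w , w∈xs) ,
                   ⊮φ ∘ ⊨ᴾ⇒⊩ φ (All.tabulate id) (w , w∈xs))
  where open Elimination.Survivors s φ viable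

completeness : ∀ s (φ : Form n) → Valid s φ → s ⊢ φ
completeness s φ valid with ⊢⊎countermodel s φ
... | inj₁ ⊢φ                       = ⊢φ
... | inj₂ (P , condition , w , ⊭φ) = contradiction (valid⇒⊨ᴾ s P condition valid w) ⊭φ

theorem50 : ∀ {n : ℕ} →
    (∀ (φ : Form n) → ValidMin φ → min ⊢ φ) × (∀ (φ : Form n) → ValidMax φ → max ⊢ φ)
theorem50 = completeness min , completeness max
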